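{- Every sentence over the signature $\sigma_1$ provable in $\mathit{HT}_{\#}$ is provable in $\mathit{HT}_{\#}^{\omega}$.
   Context: $\sigma_1$ is the two-sorted signature (general, integer) with numerals, other precomputed terms (totally ordered, numerals contiguous), integer arithmetic $|\cdot|,+,-,\times$, predicates $p/n$, comparisons $=,\neq,<,>,\leq,\geq$, and predicate constants $\mathit{Atleast}^{\mathbf{X};\mathbf{V}}_F$, $\mathit{Atmost}^{\mathbf{X};\mathbf{V}}_F$; $\sigma_2$ additionally has $\mathit{Start}^{\mathbf{X};\mathbf{V}}_F$. $\mathit{HT}_{\#}$ is first-order intuitionistic logic over $\sigma_2$ plus $F\lor(F\to G)\lor\neg G$, $\exists X(F\to\forall XF)$, Std (sentences without $p/n$ true in the standard interpretation), Ind (induction schema over nonnegative integers), $D_0$ (recursive definition of Start) and $D_1$ (Atleast/Atmost defined via Start). $\mathit{HT}_{\#}^{\omega}$ is the natural deduction system for intuitionistic first-order logic over $\sigma_1$ (on sequents $\Gamma\Rightarrow F$) extended by $F\lor(F\to G)\lor\neg G$, $\exists X(F\to\forall XF)$, Std, Defs (the sentences $\forall\mathbf{V}(\mathit{Atleast}^{\mathbf{X};\mathbf{V}}_F(\mathbf{V},r)\leftrightarrow\exists_{\geq r}\mathbf{X}F)$ and $\forall\mathbf{V}(\mathit{Atmost}^{\mathbf{X};\mathbf{V}}_F(\mathbf{V},r)\leftrightarrow\exists_{\leq r}\mathbf{X}F)$ for every precomputed term $r$, where $\exists_{\geq r}$, $\exists_{\leq r}$ are the first-order "at least $r$"/"at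 most $r$" expansions) and the $\omega$-rules: from $\Gamma\Rightarrow F^X_t$ for all precomputed terms $t$ infer $\Gamma\Rightarrow\forall XF$ ($X$ general), and from $\Gamma\Rightarrow F^N_{\overline n}$ for all integers $n$ infer $\Gamma\Rightarrow\forall NF$ ($N$ integer). -}

module Defs where

open import Data.Bool using (if_then_else_)
open import Data.Empty using (⊥)
open import Data.Fin using (Fin; zero; suc)
open import Data.Integer as ℤ using (ℤ; +_; -[1+_])
open import Data.List using (List; []; _∷_; _++_; map; foldr; concat; replicate; allFin)
open import Data.List.Membership.Propositional using (_∈_)
open import Data.List.Membership.Propositional.Properties using (∈-++⁺ˡ; ∈-++⁺ʳ)
open import Data.List.Relation.Unary.All as All using (All; []; _∷_)
open import Data.List.Relation.Unary.All.Properties using (++⁺)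
open import Data.List.Relation.Unary.Any using (here; there)
open import Data.Nat using (ℕ; suc)
open import Data.Product using (Σ; ∃-syntax; _×_; _,_)
open import Data.Sum using (_⊎_)
open import Function using (id; _∘_)
open import Level using (0ℓ)
open import Relation.Binary using (Rel; IsStrictTotalOrder)
open import Relation.Binary.PropositionalEquality using (_≡_; _≢_; refl)
open import Relation.Nullary using (¬_; does)

data Precomputed (Other : Set) : Set where
  numeral : ℤ → Precomputed Other
  other   : Other → Precomputed Other

record Vocabulary : Set₁ where
  field
    Other : Set            -- precomputed terms that are not numerals
    Name  : Set            -- the symbols p of predicate constants p/n
    _≺_   : Rel (Precomputed Other) 0ℓ
    isStrictTotalOrder : IsStrictTotalOrder _≡_ _≺_
    numeral-mono : ∀ {m n} → m ℤ.< n → numeral m ≺ numeral n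
    contiguous   : ∀ {m n r} → numeral m ≺ r → r ≺ numeral n →
                   ∃[ k ] r ≡ numeral k

data Sort : Set where
  general integer : Sort

-- Variables are well-scoped de Bruijn indices; a context lists the sorts of
-- the variables that may be free, innermost first.
Ctx : Set
Ctx = List Sort

-- Predicate constants, classified by the sorts of their arguments.  The
-- comparison symbols are not included: they belong to every signature.
Signature : Set₁
Signature = List Sort → Set

data Comparison : Set where
  eq ne lt gt le ge : Comparison

generals : ℕ → Ctx
generals n = replicate n general

module Logic (𝒱 : Vocabulary) where
  open Vocabulary 𝒱
  open IsStrictTotalOrder isStrictTotalOrder using (_<?_)

  infixl 8 _[_] _[_]₁
  infixl 7 _⊕_ _⊖_
  infixl 8 _⊗_
  infix  6 _≐_ _≐*_ _<*_
  infixr 5 _∧_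
  infixr 4 _∨_
  infixr 3 _⇒_
  infix  2 _⇔_

  PTerm : Set
  PTerm = Precomputed Other

  data Term (Δ : Ctx) : Sort → Set where
    var   : ∀ {s} → s ∈ Δ → Term Δ s
    sym   : Other → Term Δ general
    num   : ℤ → Term Δ integer
    abs   : Term Δ integer → Term Δ integer
    _⊕_ _⊖_ _⊗_ : Term Δ integer → Term Δ integer → Term Δ integer
    -- integer is a subsort of general
    ↑_    : Term Δ integer → Term Δ general

  asGeneral : ∀ {Δ s} → Term Δ s → Term Δ general
  asGeneral {s = general} t = t
  asGeneral {s = integer} t = ↑ t

  const : ∀ {Δ} → PTerm → Term Δ general
  const (numeral n) = ↑ num n
  const (other c)   = sym c

  -- Tuple Δ Γ serves both as a list of arguments of sorts Γ and as a
  -- simultaneous substitution for the variables of Γ.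
  Tuple : Ctx → List Sort → Set
  Tuple Δ Γ = All (Term Δ) Γ

  data Formula (σ : Signature) (Δ : Ctx) : Set where
    pred : ∀ {ar} → σ ar → Tuple Δ ar → Formula σ Δ
    cmp  : Comparison → Term Δ general → Term Δ general → Formula σ Δ
    ⊥ᶠ   : Formula σ Δ
    _∧_ _∨_ _⇒_ : Formula σ Δ → Formula σ Δ → Formula σ Δ
    ∀ᶠ ∃ᶠ : ∀ {s} → Formula σ (s ∷ Δ) → Formula σ Δ

  Sentence : Signature → Set
  Sentence σ = Formula σ []

  renameTerm : ∀ {Δ Δ′ s} → (∀ {s} → s ∈ Δ → s ∈ Δ′) → Term Δ s → Term Δ′ s
  renameTerm ρ (var z) = var (ρ z)
  renameTerm ρ (sym c) = sym c
  renameTerm ρ (num n) = num n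
  renameTerm ρ (abs t) = abs (renameTerm ρ t)
  renameTerm ρ (t ⊕ u) = renameTerm ρ t ⊕ renameTerm ρ u
  renameTerm ρ (t ⊖ u) = renameTerm ρ t ⊖ renameTerm ρ u
  renameTerm ρ (t ⊗ u) = renameTerm ρ t ⊗ renameTerm ρ u
  renameTerm ρ (↑ t)   = ↑ renameTerm ρ t

  substTerm : ∀ {Γ Δ s} → Tuple Δ Γ → Term Γ s → Term Δ s
  substTerm τ (var z) = All.lookup τ z
  substTerm τ (sym c) = sym c
  substTerm τ (num n) = num n
  substTerm τ (abs t) = abs (substTerm τ t)
  substTerm τ (t ⊕ u) = substTerm τ t ⊕ substTerm τ u
  substTerm τ (t ⊖ u) = substTerm τ t ⊖ substTerm τ u
  substTerm τ (t ⊗ u) = substTerm τ t ⊗ substTerm τ u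
  substTerm τ (↑ t)   = ↑ substTerm τ t

  vars : ∀ {Γ Δ} → (∀ {s} → s ∈ Γ → s ∈ Δ) → Tuple Δ Γ
  vars ρ = All.tabulate (var ∘ ρ)

  lift : ∀ {Γ Δ s} → Tuple Δ Γ → Tuple (s ∷ Δ) (s ∷ Γ)
  lift τ = var (here refl) ∷ All.map (renameTerm there) τ

  _[_] : ∀ {σ Γ Δ} → Formula σ Γ → Tuple Δ Γ → Formula σ Δ
  pred p ts [ τ ] = pred p (All.map (substTerm τ) ts)
  cmp c t u [ τ ] = cmp c (substTerm τ t) (substTerm τ u)
  ⊥ᶠ        [ τ ] = ⊥ᶠ
  (A ∧ B)   [ τ ] = (A [ τ ]) ∧ (B [ τ ])
  (A ∨ B)   [ τ ] = (A [ τ ]) ∨ (B [ τ ])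
  (A ⇒ B)   [ τ ] = (A [ τ ]) ⇒ (B [ τ ])
  ∀ᶠ A      [ τ ] = ∀ᶠ (A [ lift τ ])
  ∃ᶠ A      [ τ ] = ∃ᶠ (A [ lift τ ])

  weaken : ∀ {σ Δ s} → Formula σ Δ → Formula σ (s ∷ Δ)
  weaken A = A [ vars there ]

  _[_]₁ : ∀ {σ Δ s} → Formula σ (s ∷ Δ) → Term Δ s → Formula σ Δ
  A [ t ]₁ = A [ t ∷ vars id ]

  mapPred : ∀ {σ σ′ Δ} → (∀ {ar} → σ ar → σ′ ar) → Formula σ Δ → Formula σ′ Δ
  mapPred f (pred p ts) = pred (f p) ts
  mapPred f (cmp c t u) = cmp c t u
  mapPred f ⊥ᶠ          = ⊥ᶠ
  mapPred f (A ∧ B)     = mapPred f A ∧ mapPred f B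
  mapPred f (A ∨ B)     = mapPred f A ∨ mapPred f B
  mapPred f (A ⇒ B)     = mapPred f A ⇒ mapPred f B
  mapPred f (∀ᶠ A)      = ∀ᶠ (mapPred f A)
  mapPred f (∃ᶠ A)      = ∃ᶠ (mapPred f A)

  ¬ᶠ_ : ∀ {σ Δ} → Formula σ Δ → Formula σ Δ
  ¬ᶠ A = A ⇒ ⊥ᶠ

  ⊤ᶠ : ∀ {σ Δ} → Formula σ Δ
  ⊤ᶠ = ⊥ᶠ ⇒ ⊥ᶠ

  _⇔_ : ∀ {σ Δ} → Formula σ Δ → Formula σ Δ → Formula σ Δ
  A ⇔ B = (A ⇒ B) ∧ (B ⇒ A)

  ⋀ ⋁ : ∀ {σ Δ} → List (Formula σ Δ) → Formula σ Δ
  ⋀ = foldr _∧_ ⊤ᶠ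
  ⋁ = foldr _∨_ ⊥ᶠ

  ∀* ∃* : ∀ {σ Δ} (Γ : Ctx) → Formula σ (Γ ++ Δ) → Formula σ Δ
  ∀* []      A = A
  ∀* (_ ∷ Γ) A = ∀* Γ (∀ᶠ A)
  ∃* []      A = A
  ∃* (_ ∷ Γ) A = ∃* Γ (∃ᶠ A)

  closure : ∀ {σ} (Δ : Ctx) → Formula σ Δ → Sentence σ
  closure []      A = A
  closure (_ ∷ Δ) A = closure Δ (∀ᶠ A)

  _≐_ : ∀ {σ Δ} → Term Δ general → Term Δ general → Formula σ Δ
  t ≐ u = cmp eq t u

  _≐*_ : ∀ {σ Δ n} → Tuple Δ (generals n) → Tuple Δ (generals n) → Formula σ Δ
  _≐*_ {n = 0}     []       []       = ⊤ᶠ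
  _≐*_ {n = suc n} (t ∷ ts) (u ∷ us) = t ≐ u ∧ _≐*_ {n = n} ts us

  -- lexicographic order
  _<*_ : ∀ {σ Δ n} → Tuple Δ (generals n) → Tuple Δ (generals n) → Formula σ Δ
  _<*_ {n = 0}     []       []       = ⊥ᶠ
  _<*_ {n = suc n} (t ∷ ts) (u ∷ us) = cmp lt t u ∨ (t ≐ u ∧ _<*_ {n = n} ts us)

  data σ∅ : Signature where

  data σ₀ : Signature where
    _/_ : Name → (n : ℕ) → σ₀ (generals n)

  -- In Atleast x v F and its relatives, 𝐗 and 𝐕 are the first x and the
  -- last v variables of the context of F.  These constants are thus taken
  -- up to renaming of the variables in 𝐗 and 𝐕.
  data σ₁ : Signature where
    base    : ∀ {ar} → σ₀ ar → σ₁ ar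
    Atleast Atmost : ∀ x v → Formula σ₀ (generals x ++ generals v) →
                     σ₁ (generals v ++ (general ∷ []))

  data σ₂ : Signature where
    base  : ∀ {ar} → σ₁ ar → σ₂ ar
    Start : ∀ x v → Formula σ₀ (generals x ++ generals v) →
            σ₂ (generals x ++ generals v ++ (integer ∷ []))

  σ∅⊆ : ∀ {σ : Signature} {ar} → σ∅ ar → σ ar
  σ∅⊆ ()

  ⟦_⟧ˢ : Sort → Set
  ⟦ general ⟧ˢ = PTerm
  ⟦ integer ⟧ˢ = ℤ

  ⟦_⟧ᵗ : ∀ {Δ s} → Term Δ s → All ⟦_⟧ˢ Δ → ⟦ s ⟧ˢ
  ⟦ var z ⟧ᵗ η = All.lookup η z
  ⟦ sym c ⟧ᵗ η = other c
  ⟦ num n ⟧ᵗ η = n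
  ⟦ abs t ⟧ᵗ η = + ℤ.∣ ⟦ t ⟧ᵗ η ∣
  ⟦ t ⊕ u ⟧ᵗ η = ⟦ t ⟧ᵗ η ℤ.+ ⟦ u ⟧ᵗ η
  ⟦ t ⊖ u ⟧ᵗ η = ⟦ t ⟧ᵗ η ℤ.- ⟦ u ⟧ᵗ η
  ⟦ t ⊗ u ⟧ᵗ η = ⟦ t ⟧ᵗ η ℤ.* ⟦ u ⟧ᵗ η
  ⟦ ↑ t   ⟧ᵗ η = numeral (⟦ t ⟧ᵗ η)

  ⟦_⟧ᶜ : Comparison → PTerm → PTerm → Set
  ⟦ eq ⟧ᶜ a b = a ≡ b
  ⟦ ne ⟧ᶜ a b = a ≢ b
  ⟦ lt ⟧ᶜ a b = a ≺ b
  ⟦ gt ⟧ᶜ a b = b ≺ a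
  ⟦ le ⟧ᶜ a b = a ≺ b ⊎ a ≡ b
  ⟦ ge ⟧ᶜ a b = b ≺ a ⊎ b ≡ a

  -- Truth is classical: the double negations make every classically valid
  -- sentence true without assuming excluded middle in the metatheory (the
  -- atomic formulas are decidable).
  _⊨_ : ∀ {Δ} → All ⟦_⟧ˢ Δ → Formula σ∅ Δ → Set
  η ⊨ cmp c t u    = ⟦ c ⟧ᶜ (⟦ t ⟧ᵗ η) (⟦ u ⟧ᵗ η)
  η ⊨ ⊥ᶠ           = ⊥
  η ⊨ (A ∧ B)      = η ⊨ A × η ⊨ B
  η ⊨ (A ∨ B)      = ¬ ¬ (η ⊨ A ⊎ η ⊨ B)
  η ⊨ (A ⇒ B)      = η ⊨ A → η ⊨ B
  η ⊨ ∀ᶠ {s} A     = (a : ⟦ s ⟧ˢ) → (a ∷ η) ⊨ A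
  η ⊨ ∃ᶠ {s} A     = ¬ ¬ (Σ ⟦ s ⟧ˢ λ a → (a ∷ η) ⊨ A)

  True : Sentence σ∅ → Set
  True A = [] ⊨ A

  Axioms : Signature → Set₁
  Axioms σ = ∀ {Δ} → Formula σ Δ → Set

  data Rules : Set where
    finitary ω : Rules

  data Derivation {σ} (Ax : Axioms σ) : Rules →
                  ∀ {Δ} → List (Formula σ Δ) → Formula σ Δ → Set where
    axiom : ∀ {R Δ Γ} {A : Formula σ Δ} → Ax A → Derivation Ax R Γ A
    hyp   : ∀ {R Δ Γ} {A : Formula σ Δ} → A ∈ Γ → Derivation Ax R Γ A

    ⊥E  : ∀ {R Δ Γ} {A : Formula σ Δ} →
          Derivation Ax R Γ ⊥ᶠ → Derivation Ax R Γ A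
    ∧I  : ∀ {R Δ Γ} {A B : Formula σ Δ} →
          Derivation Ax R Γ A → Derivation Ax R Γ B → Derivation Ax R Γ (A ∧ B)
    ∧E₁ : ∀ {R Δ Γ} {A B : Formula σ Δ} →
          Derivation Ax R Γ (A ∧ B) → Derivation Ax R Γ A
    ∧E₂ : ∀ {R Δ Γ} {A B : Formula σ Δ} →
          Derivation Ax R Γ (A ∧ B) → Derivation Ax R Γ B
    ∨I₁ : ∀ {R Δ Γ} {A B : Formula σ Δ} →
          Derivation Ax R Γ A → Derivation Ax R Γ (A ∨ B)
    ∨I₂ : ∀ {R Δ Γ} {A B : Formula σ Δ} →
          Derivation Ax R Γ B → Derivation Ax R Γ (A ∨ B)
    ∨E  : ∀ {R Δ Γ} {A B C : Formula σ Δ} →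
          Derivation Ax R Γ (A ∨ B) →
          Derivation Ax R (A ∷ Γ) C → Derivation Ax R (B ∷ Γ) C →
          Derivation Ax R Γ C
    ⇒I  : ∀ {R Δ Γ} {A B : Formula σ Δ} →
          Derivation Ax R (A ∷ Γ) B → Derivation Ax R Γ (A ⇒ B)
    ⇒E  : ∀ {R Δ Γ} {A B : Formula σ Δ} →
          Derivation Ax R Γ (A ⇒ B) → Derivation Ax R Γ A → Derivation Ax R Γ B
    ∀I  : ∀ {R Δ Γ s} {A : Formula σ (s ∷ Δ)} →
          Derivation Ax R (map weaken Γ) A → Derivation Ax R Γ (∀ᶠ A)
    ∀E  : ∀ {R Δ Γ s} {A : Formula σ (s ∷ Δ)} →
          Derivation Ax R Γ (∀ᶠ A) → (t : Term Δ s) → Derivation Ax R Γ (A [ t ]₁)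
    ∃I  : ∀ {R Δ Γ s} {A : Formula σ (s ∷ Δ)} (t : Term Δ s) →
          Derivation Ax R Γ (A [ t ]₁) → Derivation Ax R Γ (∃ᶠ A)
    ∃E  : ∀ {R Δ Γ s} {A : Formula σ (s ∷ Δ)} {C : Formula σ Δ} →
          Derivation Ax R Γ (∃ᶠ A) →
          Derivation Ax R (A ∷ map weaken Γ) (weaken C) →
          Derivation Ax R Γ C

    ≐I  : ∀ {R Δ} {Γ : List (Formula σ Δ)} (t : Term Δ general) →
          Derivation Ax R Γ (t ≐ t)
    ≐E  : ∀ {R Δ Γ s} (A : Formula σ (s ∷ Δ)) {t u : Term Δ s} →
          Derivation Ax R Γ (asGeneral t ≐ asGeneral u) →
          Derivation Ax R Γ (A [ t ]₁) → Derivation Ax R Γ (A [ u ]₁)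

    ω-general : ∀ {Δ Γ} {A : Formula σ (general ∷ Δ)} →
                ((r : PTerm) → Derivation Ax ω Γ (A [ const r ]₁)) →
                Derivation Ax ω Γ (∀ᶠ A)
    ω-integer : ∀ {Δ Γ} {A : Formula σ (integer ∷ Δ)} →
                ((n : ℤ) → Derivation Ax ω Γ (A [ num n ]₁)) →
                Derivation Ax ω Γ (∀ᶠ A)

  -- The axioms common to both systems.  A sentence S used as an axiom in a
  -- context Δ appears as S [ [] ].
  data CommonAxiom {σ} {Δ} : Formula σ Δ → Set where
    hosoi : ∀ F G → CommonAxiom (F ∨ (F ⇒ G) ∨ (¬ᶠ G))
    sqht  : ∀ {s} (F : Formula σ (s ∷ Δ)) →
            CommonAxiom (∃ᶠ (F ⇒ weaken (∀ᶠ F)))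
    std   : (S : Sentence σ∅) → True S → CommonAxiom (mapPred (σ∅⊆ {σ}) S [ [] ])

  induction : ∀ {Δ} → Formula σ₂ (integer ∷ Δ) → Formula σ₂ Δ
  induction F = (F [ num (+ 0) ]₁) ∧ ∀ᶠ (N≥0 ∧ F ⇒ F [ N ⊕ num (+ 1) ∷ vars there ])
                ⇒ ∀ᶠ (N≥0 ⇒ F)
    where
    N : ∀ {Δ} → Term (integer ∷ Δ) integer
    N = var (here refl)
    N≥0 : ∀ {Δ} → Formula σ₂ (integer ∷ Δ)
    N≥0 = cmp ge (↑ N) (↑ num (+ 0))

  module _ (x v : ℕ) (F : Formula σ₀ (generals x ++ generals v)) where

    start : ∀ {Δ} → Tuple Δ (generals x) → Tuple Δ (generals v) →
            Term Δ integer → Formula σ₂ Δ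
    start X V N = pred (Start x v F) (++⁺ X (++⁺ V (N ∷ [])))

    atleast₁ atmost₁ : ∀ {Δ} → Tuple Δ (generals v) → Term Δ general → Formula σ₁ Δ
    atleast₁ V Y = pred (Atleast x v F) (++⁺ V (Y ∷ []))
    atmost₁  V Y = pred (Atmost  x v F) (++⁺ V (Y ∷ []))

    -- Start(𝐗,𝐕,N) for N > 0 says that some lexicographically increasing
    -- sequence of N values satisfying F begins with 𝐗.
    module D₀ where
      Δ : Ctx
      Δ = generals x ++ generals v ++ (integer ∷ [])

      X : Tuple Δ (generals x)
      X = vars ∈-++⁺ˡ

      V : Tuple Δ (generals v)
      V = vars (∈-++⁺ʳ (generals x) ∘ ∈-++⁺ˡ)

      N : Term Δ integer
      N = var (∈-++⁺ʳ (generals x) (∈-++⁺ʳ (generals v) (here refl)))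

      F′ : Formula σ₂ Δ
      F′ = mapPred (σ₂.base ∘ σ₁.base) F [ ++⁺ X V ]

      start≤0 start₁ start₊ : Sentence σ₂

      start≤0 = closure Δ (cmp le (↑ N) (↑ num (+ 0)) ⇒ start X V N)

      start₁ = closure Δ (start X V (num (+ 1)) ⇔ F′)

      start₊ = closure Δ (cmp gt (↑ N) (↑ num (+ 0)) ⇒
                 (start X V (N ⊕ num (+ 1)) ⇔
                  F′ ∧ ∃* (generals x) (_<*_ {n = x} (up X) U ∧ start U (up V) (up₁ N))))
        where
        up₁ : ∀ {s} → Term Δ s → Term (generals x ++ Δ) s
        up₁ = renameTerm (∈-++⁺ʳ (generals x))
        up : ∀ {Γ} → Tuple Δ Γ → Tuple (generals x ++ Δ) Γ
        up = All.map up₁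
        U : Tuple (generals x ++ Δ) (generals x)
        U = vars ∈-++⁺ˡ

    module D₁ where
      Δ Δ′ : Ctx
      Δ  = generals v ++ (general ∷ [])
      Δ′ = (generals x ++ (integer ∷ [])) ++ Δ

      V : Tuple Δ (generals v)
      V = vars ∈-++⁺ˡ

      Y : Term Δ general
      Y = var (∈-++⁺ʳ (generals v) (here refl))

      X : Tuple Δ′ (generals x)
      X = vars (∈-++⁺ˡ ∘ ∈-++⁺ˡ)

      N : Term Δ′ integer
      N = var (∈-++⁺ˡ (∈-++⁺ʳ (generals x) (here refl)))

      up : ∀ {s} → Term Δ s → Term Δ′ s
      up = renameTerm (∈-++⁺ʳ (generals x ++ (integer ∷ [])))

      atleast-def atmost-def : Sentence σ₂

      atleast-def = closure Δ (mapPred base (atleast₁ V Y) ⇔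
        ∃* (generals x ++ (integer ∷ [])) (start X (All.map up V) N ∧ cmp ge (↑ N) (up Y)))

      atmost-def = closure Δ (mapPred base (atmost₁ V Y) ⇔
        ∀* (generals x ++ (integer ∷ [])) (start X (All.map up V) N ⇒ cmp le (↑ N) (up Y)))

  data HT#-Axiom {Δ} : Formula σ₂ Δ → Set where
    common      : ∀ {A} → CommonAxiom A → HT#-Axiom A
    ind         : ∀ F → HT#-Axiom (induction F)
    start≤0     : ∀ x v F → HT#-Axiom (D₀.start≤0 x v F [ [] ])
    start₁      : ∀ x v F → HT#-Axiom (D₀.start₁ x v F [ [] ])
    start₊      : ∀ x v F → HT#-Axiom (D₀.start₊ x v F [ [] ])
    atleast-def : ∀ x v F → HT#-Axiom (D₁.atleast-def x v F [ [] ])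
    atmost-def  : ∀ x v F → HT#-Axiom (D₁.atmost-def x v F [ [] ])

  HT#⊢_ : Sentence σ₂ → Set
  HT#⊢ A = Derivation HT#-Axiom finitary [] A

  pairs : ∀ {a} {A : Set a} → List A → List (A × A)
  pairs []       = []
  pairs (a ∷ as) = map (a ,_) as ++ pairs as

  module Counting {σ Δ} (x : ℕ) (F : Formula σ (generals x ++ Δ)) where

    block : ℕ → Ctx
    block n = concat (replicate n (generals x))

    inBlock : ∀ {n s} → Fin n → s ∈ generals x → s ∈ block n
    inBlock zero    z = ∈-++⁺ˡ z
    inBlock (suc i) z = ∈-++⁺ʳ (generals x) (inBlock i z)

    -- 𝐗₁, …, 𝐗ₙ
    copies : ∀ n → List (Tuple (block n ++ Δ) (generals x))
    copies n = map (λ i → vars (∈-++⁺ˡ ∘ inBlock i)) (allFin n)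

    all-F : ∀ n → Formula σ (block n ++ Δ)
    all-F n = ⋀ (map (λ X → F [ ++⁺ X (vars (∈-++⁺ʳ (block n))) ]) (copies n))

    -- A precomputed term that is not a numeral either precedes or follows
    -- all numerals, so it suffices to compare it with 0.
    ∃≥ ∃≤ : PTerm → Formula σ Δ

    ∃≥ (numeral (+ 0))      = ⊤ᶠ
    ∃≥ (numeral -[1+ _ ])   = ⊤ᶠ
    ∃≥ (numeral (+ suc k))  = ∃* (block n)
      (all-F n ∧ ⋀ (map (λ (X , X′) → ¬ᶠ (_≐*_ {n = x} X X′)) (pairs (copies n))))
      where n = suc k
    ∃≥ (other c) = if does (other c <? numeral (+ 0)) then ⊤ᶠ else ⊥ᶠ

    ∃≤ (numeral (+ n))    = ∀* (block (suc n))
      (all-F (suc n) ⇒ ⋁ (map (λ (X , X′) → _≐*_ {n = x} X X′) (pairs (copies (suc n)))))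
    ∃≤ (numeral -[1+ _ ]) = ⊥ᶠ
    ∃≤ (other c) = if does (other c <? numeral (+ 0)) then ⊥ᶠ else ⊤ᶠ

  open Counting using (∃≥; ∃≤)

  atleast-Def atmost-Def : ∀ x v → Formula σ₀ (generals x ++ generals v) →
                           PTerm → Sentence σ₁
  atleast-Def x v F r = closure (generals v)
    (atleast₁ x v F (vars id) (const r) ⇔ ∃≥ x (mapPred base F) r)
  atmost-Def x v F r = closure (generals v)
    (atmost₁ x v F (vars id) (const r) ⇔ ∃≤ x (mapPred base F) r)

  data HT#ω-Axiom {Δ} : Formula σ₁ Δ → Set where
    common  : ∀ {A} → CommonAxiom A → HT#ω-Axiom A
    atleast : ∀ x v F r → HT#ω-Axiom (atleast-Def x v F r [ [] ])
    atmost  : ∀ x v F r → HT#ω-Axiom (atmost-Def x v F r [ [] ])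

  HT#ω⊢_ : Sentence σ₁ → Set
  HT#ω⊢ A = Derivation HT#ω-Axiom ω [] A

-- Interpret Start(𝐗,𝐕,N) by the σ₁-formula "N ≤ 0, or 𝐗 satisfies F and at
-- least N tuples 𝐖 satisfy F and do not lexicographically precede 𝐗", the
-- last condition being an Atleast atom with parameters 𝐗 and 𝐕.  By induction
-- on derivations, a derivation in HT# yields, for every substitution of closed
-- terms, a derivation of the interpreted sequent by the ω-rules, which make
-- induction derivable and reduce D₀ and D₁ to instances at precomputed terms.
-- There Atleast, Atmost and Start can all be introduced and eliminated through
-- increasing sequences of tuples for which F is derivable: comparisons are
-- decided by Std, so any family of distinct tuples can be sorted outside the
-- calculus, although the truth of F itself is not decided.
module Submission where

open import Defs
open import Data.Empty using (⊥; ⊥-elim)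
open import Data.Fin using (Fin; zero; suc)
open import Data.Integer as ℤ using (ℤ; +_; -[1+_])
import Data.Integer.Properties as ℤ
open import Data.List using (List; []; _∷_; _++_; map; length; lookup; take; tabulate; allFin)
open import Data.List.Membership.Propositional using (_∈_)
open import Data.List.Membership.Propositional.Properties using (∈-++⁺ˡ; ∈-++⁺ʳ; ∈-map⁺)
open import Data.List.Properties
  using (map-∘; map-cong; length-take; length-map; length-tabulate; tabulate-cong; tabulate-lookup)
  renaming (map-tabulate to map-tabulateᴸ; map-++ to map-++ᴸ)
open import Data.List.Relation.Binary.Subset.Propositional using (_⊆_)
open import Data.List.Relation.Binary.Subset.Propositional.Properties
  using (map⁺; ∷⁺ʳ)
open import Data.List.Relation.Binary.Permutation.Propositional
  using (_↭_; ↭-refl; ↭-sym; ↭-trans; prep; swap)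
open import Data.List.Relation.Binary.Permutation.Propositional.Properties
  using (All-resp-↭; ↭-length)
open import Data.List.Relation.Unary.All as All using (All; []; _∷_)
open import Data.List.Relation.Unary.All.Properties as All using (++⁺; ¬Any⇒All¬)
open import Data.List.Relation.Unary.AllPairs as AllPairs using (AllPairs; []; _∷_)
import Data.List.Relation.Unary.AllPairs.Properties as AllPairs
open import Data.List.Relation.Unary.Any as Any using (Any; here; there)
import Data.List.Relation.Unary.Any.Properties as Any
open import Data.Nat as ℕ using (ℕ; suc; s≤s; z≤n)
import Data.Nat.Properties as ℕ
open import Data.Product using (∃-syntax; _×_; _,_; uncurry)
open import Data.Sum using (_⊎_; inj₁; inj₂)
open import Function using (id; _∘_; _on_)
open import Level using (0ℓ)
open import Relation.Binary
  using (Rel; IsStrictTotalOrder; Transitive; Trichotomous; tri<; tri≈; tri>)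
open import Relation.Binary.Consequences using (tri⇒dec≈)
open import Relation.Binary.PropositionalEquality
  using (_≡_; _≢_; refl; sym; trans; cong; cong₂; subst; subst₂; module ≡-Reasoning)
open import Relation.Nullary using (¬_; contradiction; yes; no)

-- An `Atleast` atom can: its last argument carries N, and its parameters have room for 𝐗. The
-- second obstacle is that nothing decides which tuples satisfy F. A sequence of tuples is therefore
-- available only relative to hypotheses: it appears while existential quantifiers are being
-- eliminated, in a context larger than the initial one. Eliminations are accordingly stated with
-- continuations over all larger contexts, and case distinctions outside the calculus concern only
-- comparisons of integers, of precomputed terms and of tuples of these.

module _ {a p} {A : Set a} {P : A → Set p} where

  lookup-tabulate : ∀ {xs} (f : ∀ {x} → x ∈ xs → P x) {x} (z : x ∈ xs) →
                    All.lookup (All.tabulate f) z ≡ f z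
  lookup-tabulate f (here refl) = refl
  lookup-tabulate f (there z)   = lookup-tabulate (f ∘ there) z

  All-ext : ∀ {xs} {ps qs : All P xs} →
            (∀ {x} (z : x ∈ xs) → All.lookup ps z ≡ All.lookup qs z) → ps ≡ qs
  All-ext {ps = []}    {[]}    e = refl
  All-ext {ps = _ ∷ _} {_ ∷ _} e = cong₂ _∷_ (e (here refl)) (All-ext (e ∘ there))

  lookup-++ˡ : ∀ {xs ys} (ps : All P xs) (qs : All P ys) {x} (z : x ∈ xs) →
               All.lookup (++⁺ ps qs) (∈-++⁺ˡ z) ≡ All.lookup ps z
  lookup-++ˡ (p ∷ ps) qs (here refl) = refl
  lookup-++ˡ (p ∷ ps) qs (there z)   = lookup-++ˡ ps qs z

  lookup-++ʳ : ∀ {xs ys} (ps : All P xs) (qs : All P ys) {x} (z : x ∈ ys) →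
               All.lookup (++⁺ ps qs) (∈-++⁺ʳ xs z) ≡ All.lookup qs z
  lookup-++ʳ []       qs z = refl
  lookup-++ʳ (p ∷ ps) qs z = lookup-++ʳ ps qs z

module _ {a p q} {A : Set a} {P : A → Set p} {Q : A → Set q} where

  lookup-map : ∀ {xs} {f : ∀ {x} → P x → Q x} (ps : All P xs) {x} (z : x ∈ xs) →
               All.lookup (All.map f ps) z ≡ f (All.lookup ps z)
  lookup-map (p ∷ ps) (here refl) = refl
  lookup-map (p ∷ ps) (there z)   = lookup-map ps z

  map-tabulate : ∀ {xs} (f : ∀ {x} → P x → Q x) (g : ∀ {x} → x ∈ xs → P x) →
                 All.map f (All.tabulate g) ≡ All.tabulate (f ∘ g)
  map-tabulate {[]}     f g = refl
  map-tabulate {x ∷ xs} f g = cong (f (g (here refl)) ∷_) (map-tabulate f (g ∘ there))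

  map-++ : ∀ {xs ys} {f : ∀ {x} → P x → Q x} (ps : All P xs) (qs : All P ys) →
           All.map f (++⁺ ps qs) ≡ ++⁺ (All.map f ps) (All.map f qs)
  map-++ []       qs = refl
  map-++ (p ∷ ps) qs = cong (_ ∷_) (map-++ ps qs)

  map-cong-All : ∀ {xs} {f g : ∀ {x} → P x → Q x} → (∀ {x} (p : P x) → f p ≡ g p) →
                 (ps : All P xs) → All.map f ps ≡ All.map g ps
  map-cong-All e []       = refl
  map-cong-All e (p ∷ ps) = cong₂ _∷_ (e p) (map-cong-All e ps)

-- Insertion sort for pairwise distinct elements.

module Sorting {A : Set} {_<_ : Rel A 0ℓ}
               (<-trans : Transitive _<_) (compare : Trichotomous _≡_ _<_) where

  insert : ∀ y {xs} → AllPairs _<_ xs → All (y ≢_) xs → ∃[ ys ] AllPairs _<_ ys × ys ↭ y ∷ xs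
  insert y {[]}     s          y≢xs         = y ∷ [] , [] ∷ [] , ↭-refl
  insert y {x ∷ xs} (x< ∷ s)   (y≢x ∷ y≢xs) with compare y x
  ... | tri< y<x _ _ = y ∷ x ∷ xs , (y<x ∷ All.map (<-trans y<x) x<) ∷ x< ∷ s , ↭-refl
  ... | tri≈ _ y≡x _ = contradiction y≡x y≢x
  ... | tri> _ _ x<y with insert y s y≢xs
  ...   | ys , s′ , p = x ∷ ys , All-resp-↭ (↭-sym p) (x<y ∷ x<) ∷ s′ ,
                        ↭-trans (prep x p) (swap x y ↭-refl)

  -- Distinctness excludes the equal case of trichotomy, so the result is strictly increasing. The
  -- permutation is returned because lengths and derivability of the entries are carried across it.
  sort : ∀ {xs} → AllPairs _≢_ xs → ∃[ ys ] AllPairs _<_ ys × ys ↭ xs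
  sort []         = [] , [] , ↭-refl
  sort (x≢ ∷ xs≢) with sort xs≢
  ... | ys , s , p with insert _ s (All-resp-↭ (↭-sym p) x≢)
  ...   | zs , s′ , q = zs , s′ , ↭-trans q (prep _ p)

module _ (𝒱 : Vocabulary) where
  open Vocabulary 𝒱
  open Logic 𝒱 renaming (sym to symbol)
  open ≡-Reasoning
  open IsStrictTotalOrder isStrictTotalOrder using (compare; _<?_)
    renaming (asym to ≺-asym; trans to ≺-trans; irrefl to ≺-irrefl)

  -- Composition of substitutions.

  infixl 7 _⨾_
  _⨾_ : ∀ {Γ Δ Θ} → Tuple Δ Γ → Tuple Θ Δ → Tuple Θ Γ
  ρ ⨾ τ = All.map (substTerm τ) ρ

  substTerm-⨾ : ∀ {Γ Δ Θ s} (ρ : Tuple Δ Γ) (τ : Tuple Θ Δ) (t : Term Γ s) →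
                substTerm τ (substTerm ρ t) ≡ substTerm (ρ ⨾ τ) t
  substTerm-⨾ ρ τ (var z) = sym (lookup-map ρ z)
  substTerm-⨾ ρ τ (symbol c) = refl
  substTerm-⨾ ρ τ (num n) = refl
  substTerm-⨾ ρ τ (abs t) = cong abs (substTerm-⨾ ρ τ t)
  substTerm-⨾ ρ τ (t ⊕ u) = cong₂ _⊕_ (substTerm-⨾ ρ τ t) (substTerm-⨾ ρ τ u)
  substTerm-⨾ ρ τ (t ⊖ u) = cong₂ _⊖_ (substTerm-⨾ ρ τ t) (substTerm-⨾ ρ τ u)
  substTerm-⨾ ρ τ (t ⊗ u) = cong₂ _⊗_ (substTerm-⨾ ρ τ t) (substTerm-⨾ ρ τ u)
  substTerm-⨾ ρ τ (↑ t)   = cong ↑_ (substTerm-⨾ ρ τ t)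

  substTerm-vars : ∀ {Γ Δ s} (ρ : ∀ {s} → s ∈ Γ → s ∈ Δ) (t : Term Γ s) →
                   substTerm (vars ρ) t ≡ renameTerm ρ t
  substTerm-vars ρ (var z) = lookup-tabulate (var ∘ ρ) z
  substTerm-vars ρ (symbol c) = refl
  substTerm-vars ρ (num n) = refl
  substTerm-vars ρ (abs t) = cong abs (substTerm-vars ρ t)
  substTerm-vars ρ (t ⊕ u) = cong₂ _⊕_ (substTerm-vars ρ t) (substTerm-vars ρ u)
  substTerm-vars ρ (t ⊖ u) = cong₂ _⊖_ (substTerm-vars ρ t) (substTerm-vars ρ u)
  substTerm-vars ρ (t ⊗ u) = cong₂ _⊗_ (substTerm-vars ρ t) (substTerm-vars ρ u)
  substTerm-vars ρ (↑ t)   = cong ↑_ (substTerm-vars ρ t)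

  renameTerm-id : ∀ {Γ s} (t : Term Γ s) → renameTerm id t ≡ t
  renameTerm-id (var z) = refl
  renameTerm-id (symbol c) = refl
  renameTerm-id (num n) = refl
  renameTerm-id (abs t) = cong abs (renameTerm-id t)
  renameTerm-id (t ⊕ u) = cong₂ _⊕_ (renameTerm-id t) (renameTerm-id u)
  renameTerm-id (t ⊖ u) = cong₂ _⊖_ (renameTerm-id t) (renameTerm-id u)
  renameTerm-id (t ⊗ u) = cong₂ _⊗_ (renameTerm-id t) (renameTerm-id u)
  renameTerm-id (↑ t)   = cong ↑_ (renameTerm-id t)

  substTerm-id : ∀ {Γ s} (t : Term Γ s) → substTerm (vars id) t ≡ t
  substTerm-id t = trans (substTerm-vars id t) (renameTerm-id t)

  vars-⨾ : ∀ {Γ Δ Θ} (ρ : ∀ {s} → s ∈ Γ → s ∈ Δ) (τ : Tuple Θ Δ) →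
           vars ρ ⨾ τ ≡ All.tabulate (All.lookup τ ∘ ρ)
  vars-⨾ ρ τ = map-tabulate (substTerm τ) (var ∘ ρ)

  vars-⨾-≡ : ∀ {Γ Δ Θ} {ρ : ∀ {s} → s ∈ Γ → s ∈ Δ} {τ : Tuple Θ Δ} {υ : Tuple Θ Γ} →
             (∀ {s} (z : s ∈ Γ) → All.lookup τ (ρ z) ≡ All.lookup υ z) → vars ρ ⨾ τ ≡ υ
  vars-⨾-≡ {ρ = ρ} {τ} e = trans (vars-⨾ ρ τ)
    (All-ext λ z → trans (lookup-tabulate (All.lookup τ ∘ ρ) z) (e z))

  ⨾-id : ∀ {Γ Δ} (τ : Tuple Δ Γ) → τ ⨾ vars id ≡ τ
  ⨾-id []      = refl
  ⨾-id (t ∷ τ) = cong₂ _∷_ (substTerm-id t) (⨾-id τ)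

  id-⨾ : ∀ {Γ Δ} (τ : Tuple Δ Γ) → vars id ⨾ τ ≡ τ
  id-⨾ τ = vars-⨾-≡ λ _ → refl

  ⨾-assoc : ∀ {Γ Δ Θ Ξ} (ρ : Tuple Δ Γ) (τ : Tuple Θ Δ) (υ : Tuple Ξ Θ) →
            ρ ⨾ τ ⨾ υ ≡ ρ ⨾ (τ ⨾ υ)
  ⨾-assoc []      τ υ = refl
  ⨾-assoc (t ∷ ρ) τ υ = cong₂ _∷_ (substTerm-⨾ τ υ t) (⨾-assoc ρ τ υ)

  map-rename : ∀ {Γ Δ Θ} (τ : Tuple Δ Γ) (ρ : ∀ {s} → s ∈ Δ → s ∈ Θ) →
               All.map (renameTerm ρ) τ ≡ τ ⨾ vars ρ
  map-rename τ ρ = map-cong-All (λ t → sym (substTerm-vars ρ t)) τ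

  there-⨾ : ∀ {Γ Δ s} (t : Term Δ s) (τ : Tuple Δ Γ) → vars there ⨾ (t ∷ τ) ≡ τ
  there-⨾ t τ = vars-⨾-≡ λ _ → refl

  map-there-⨾ : ∀ {Γ Δ Θ s} (τ : Tuple Δ Γ) (t : Term Θ s) (υ : Tuple Θ Δ) →
                All.map (renameTerm there) τ ⨾ (t ∷ υ) ≡ τ ⨾ υ
  map-there-⨾ τ t υ = begin
    All.map (renameTerm there) τ ⨾ (t ∷ υ)  ≡⟨ cong (_⨾ (t ∷ υ)) (map-rename τ there) ⟩
    τ ⨾ vars there ⨾ (t ∷ υ)                ≡⟨ ⨾-assoc τ (vars there) (t ∷ υ) ⟩
    τ ⨾ (vars there ⨾ (t ∷ υ))              ≡⟨ cong (τ ⨾_) (there-⨾ t υ) ⟩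
    τ ⨾ υ                                   ∎

  lift-∷ : ∀ {Γ Δ Θ s} (τ : Tuple Δ Γ) (t : Term Θ s) (υ : Tuple Θ Δ) →
           lift τ ⨾ (t ∷ υ) ≡ t ∷ (τ ⨾ υ)
  lift-∷ τ t υ = cong (t ∷_) (map-there-⨾ τ t υ)

  lift-⨾ : ∀ {Γ Δ Θ s} (ρ : Tuple Δ Γ) (τ : Tuple Θ Δ) →
           lift {s = s} ρ ⨾ lift τ ≡ lift (ρ ⨾ τ)
  lift-⨾ ρ τ = trans (lift-∷ ρ _ _) (cong (_ ∷_) (begin
    ρ ⨾ All.map (renameTerm there) τ      ≡⟨ cong (ρ ⨾_) (map-rename τ there) ⟩
    ρ ⨾ (τ ⨾ vars there)                  ≡⟨ ⨾-assoc ρ τ (vars there) ⟨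
    ρ ⨾ τ ⨾ vars there                    ≡⟨ map-rename (ρ ⨾ τ) there ⟨
    All.map (renameTerm there) (ρ ⨾ τ)    ∎))

  lift-id : ∀ {Γ s} → lift {s = s} (vars (id {A = _ ∈ Γ})) ≡ vars id
  lift-id = cong (_ ∷_) (map-tabulate (renameTerm there) var)

  module _ {σ : Signature} where

    []-⨾ : ∀ {Γ Δ Θ} (A : Formula σ Γ) (ρ : Tuple Δ Γ) (τ : Tuple Θ Δ) →
           A [ ρ ] [ τ ] ≡ A [ ρ ⨾ τ ]
    []-⨾ (pred p ts) ρ τ = cong (pred p) (⨾-assoc ts ρ τ)
    []-⨾ (cmp c t u) ρ τ = cong₂ (cmp c) (substTerm-⨾ ρ τ t) (substTerm-⨾ ρ τ u)
    []-⨾ ⊥ᶠ          ρ τ = refl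
    []-⨾ (A ∧ B)     ρ τ = cong₂ _∧_ ([]-⨾ A ρ τ) ([]-⨾ B ρ τ)
    []-⨾ (A ∨ B)     ρ τ = cong₂ _∨_ ([]-⨾ A ρ τ) ([]-⨾ B ρ τ)
    []-⨾ (A ⇒ B)     ρ τ = cong₂ _⇒_ ([]-⨾ A ρ τ) ([]-⨾ B ρ τ)
    []-⨾ (∀ᶠ A)      ρ τ =
      cong ∀ᶠ (trans ([]-⨾ A (lift ρ) (lift τ)) (cong (A [_]) (lift-⨾ ρ τ)))
    []-⨾ (∃ᶠ A)      ρ τ =
      cong ∃ᶠ (trans ([]-⨾ A (lift ρ) (lift τ)) (cong (A [_]) (lift-⨾ ρ τ)))

    []-id : ∀ {Γ} (A : Formula σ Γ) → A [ vars id ] ≡ A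
    []-id (pred p ts) = cong (pred p) (⨾-id ts)
    []-id (cmp c t u) = cong₂ (cmp c) (substTerm-id t) (substTerm-id u)
    []-id ⊥ᶠ          = refl
    []-id (A ∧ B)     = cong₂ _∧_ ([]-id A) ([]-id B)
    []-id (A ∨ B)     = cong₂ _∨_ ([]-id A) ([]-id B)
    []-id (A ⇒ B)     = cong₂ _⇒_ ([]-id A) ([]-id B)
    []-id (∀ᶠ A)      = cong ∀ᶠ (trans (cong (A [_]) lift-id) ([]-id A))
    []-id (∃ᶠ A)      = cong ∃ᶠ (trans (cong (A [_]) lift-id) ([]-id A))

    weaken-∷ : ∀ {Γ Δ s} (A : Formula σ Γ) (t : Term Δ s) (τ : Tuple Δ Γ) →
               weaken A [ t ∷ τ ] ≡ A [ τ ]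
    weaken-∷ A t τ = trans ([]-⨾ A _ _) (cong (A [_]) (there-⨾ t τ))

    weaken-[]₁ : ∀ {Γ s} (A : Formula σ Γ) (t : Term Γ s) → weaken A [ t ]₁ ≡ A
    weaken-[]₁ A t = trans (weaken-∷ A t (vars id)) ([]-id A)

    lift-[]₁ : ∀ {Γ Δ s} (A : Formula σ (s ∷ Γ)) (τ : Tuple Δ Γ) (t : Term Δ s) →
               A [ lift τ ] [ t ]₁ ≡ A [ t ∷ τ ]
    lift-[]₁ A τ t = trans ([]-⨾ A _ _)
      (cong (A [_]) (trans (lift-∷ τ t _) (cong (t ∷_) (⨾-id τ))))

    []₁-[] : ∀ {Γ Δ s} (A : Formula σ (s ∷ Γ)) (t : Term Γ s) (τ : Tuple Δ Γ) →
             A [ t ]₁ [ τ ] ≡ A [ substTerm τ t ∷ τ ]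
    []₁-[] A t τ = trans ([]-⨾ A _ _) (cong (λ υ → A [ substTerm τ t ∷ υ ]) (id-⨾ τ))

    weaken-lift : ∀ {Γ Δ s} (A : Formula σ Γ) (τ : Tuple Δ Γ) →
                  weaken A [ lift {s = s} τ ] ≡ weaken (A [ τ ])
    weaken-lift A τ = begin
      weaken A [ lift τ ]                   ≡⟨ weaken-∷ A _ _ ⟩
      A [ All.map (renameTerm there) τ ]    ≡⟨ cong (A [_]) (map-rename τ there) ⟩
      A [ τ ⨾ vars there ]                  ≡⟨ []-⨾ A τ _ ⟨
      weaken (A [ τ ])                      ∎

  -- Interpretation of predicate constants by formulas.

  interpret : ∀ {σ σ′ : Signature} → (∀ {ar} → σ ar → Formula σ′ ar) →
              ∀ {Δ} → Formula σ Δ → Formula σ′ Δ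
  interpret θ (pred p ts) = θ p [ ts ]
  interpret θ (cmp c t u) = cmp c t u
  interpret θ ⊥ᶠ          = ⊥ᶠ
  interpret θ (A ∧ B)     = interpret θ A ∧ interpret θ B
  interpret θ (A ∨ B)     = interpret θ A ∨ interpret θ B
  interpret θ (A ⇒ B)     = interpret θ A ⇒ interpret θ B
  interpret θ (∀ᶠ A)      = ∀ᶠ (interpret θ A)
  interpret θ (∃ᶠ A)      = ∃ᶠ (interpret θ A)

  module _ {σ σ′ : Signature} (θ : ∀ {ar} → σ ar → Formula σ′ ar) where

    -- The context of `θ p` is the arity of `p`, so the arguments of an atom are themselves a
    -- substitution; the atomic case is then the composition law, and capture cannot occur.
    interpret-[] : ∀ {Γ Δ} (A : Formula σ Γ) (τ : Tuple Δ Γ) →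
                   interpret θ (A [ τ ]) ≡ interpret θ A [ τ ]
    interpret-[] (pred p ts) τ = sym ([]-⨾ (θ p) ts τ)
    interpret-[] (cmp c t u) τ = refl
    interpret-[] ⊥ᶠ          τ = refl
    interpret-[] (A ∧ B)     τ = cong₂ _∧_ (interpret-[] A τ) (interpret-[] B τ)
    interpret-[] (A ∨ B)     τ = cong₂ _∨_ (interpret-[] A τ) (interpret-[] B τ)
    interpret-[] (A ⇒ B)     τ = cong₂ _⇒_ (interpret-[] A τ) (interpret-[] B τ)
    interpret-[] (∀ᶠ A)      τ = cong ∀ᶠ (interpret-[] A (lift τ))
    interpret-[] (∃ᶠ A)      τ = cong ∃ᶠ (interpret-[] A (lift τ))

    -- Needed for three inclusions: of `σ∅`, where the hypothesis is vacuous, for Std; of `σ₀`, for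
    -- the formulas that are counted; and of `σ₁`, for the sentence to be proved.
    interpret-mapPred : ∀ {σ″ : Signature} {f : ∀ {ar} → σ″ ar → σ ar}
                        {g : ∀ {ar} → σ″ ar → σ′ ar} →
                        (∀ {ar} (p : σ″ ar) → θ (f p) ≡ pred (g p) (vars id)) →
                        ∀ {Δ} (A : Formula σ″ Δ) →
                        interpret θ (mapPred f A) ≡ mapPred g A
    interpret-mapPred {g = g} e (pred p ts) =
      trans (cong (_[ ts ]) (e p)) (cong (pred (g p)) (id-⨾ ts))
    interpret-mapPred e (cmp c t u) = refl
    interpret-mapPred e ⊥ᶠ          = refl
    interpret-mapPred e (A ∧ B)     = cong₂ _∧_ (interpret-mapPred e A) (interpret-mapPred e B)
    interpret-mapPred e (A ∨ B)     = cong₂ _∨_ (interpret-mapPred e A) (interpret-mapPred e B)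
    interpret-mapPred e (A ⇒ B)     = cong₂ _⇒_ (interpret-mapPred e A) (interpret-mapPred e B)
    interpret-mapPred e (∀ᶠ A)      = cong ∀ᶠ (interpret-mapPred e A)
    interpret-mapPred e (∃ᶠ A)      = cong ∃ᶠ (interpret-mapPred e A)

    interpret-closure : ∀ Δ (A : Formula σ Δ) →
                        interpret θ (closure Δ A) ≡ closure Δ (interpret θ A)
    interpret-closure []      A = refl
    interpret-closure (_ ∷ Δ) A = interpret-closure Δ (∀ᶠ A)

    interpret-∀* : ∀ Γ {Δ} (A : Formula σ (Γ ++ Δ)) →
                   interpret θ (∀* Γ A) ≡ ∀* Γ (interpret θ A)
    interpret-∀* []      A = refl
    interpret-∀* (_ ∷ Γ) A = interpret-∀* Γ (∀ᶠ A)

    interpret-∃* : ∀ Γ {Δ} (A : Formula σ (Γ ++ Δ)) →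
                   interpret θ (∃* Γ A) ≡ ∃* Γ (interpret θ A)
    interpret-∃* []      A = refl
    interpret-∃* (_ ∷ Γ) A = interpret-∃* Γ (∃ᶠ A)

  -- Derivations of sentences by the ω-rules.

  weakening : ∀ {σ} {Ax : Axioms σ} {R Δ Γ Γ′} {A : Formula σ Δ} →
              Γ ⊆ Γ′ → Derivation Ax R Γ A → Derivation Ax R Γ′ A
  weakening Γ⊆ (axiom a)       = axiom a
  weakening Γ⊆ (hyp z)         = hyp (Γ⊆ z)
  weakening Γ⊆ (⊥E d)          = ⊥E (weakening Γ⊆ d)
  weakening Γ⊆ (∧I d e)        = ∧I (weakening Γ⊆ d) (weakening Γ⊆ e)
  weakening Γ⊆ (∧E₁ d)         = ∧E₁ (weakening Γ⊆ d)
  weakening Γ⊆ (∧E₂ d)         = ∧E₂ (weakening Γ⊆ d)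
  weakening Γ⊆ (∨I₁ d)         = ∨I₁ (weakening Γ⊆ d)
  weakening Γ⊆ (∨I₂ d)         = ∨I₂ (weakening Γ⊆ d)
  weakening Γ⊆ (∨E d e f)      =
    ∨E (weakening Γ⊆ d) (weakening (∷⁺ʳ _ Γ⊆) e) (weakening (∷⁺ʳ _ Γ⊆) f)
  weakening Γ⊆ (⇒I d)          = ⇒I (weakening (∷⁺ʳ _ Γ⊆) d)
  weakening Γ⊆ (⇒E d e)        = ⇒E (weakening Γ⊆ d) (weakening Γ⊆ e)
  weakening Γ⊆ (∀I d)          = ∀I (weakening (map⁺ weaken Γ⊆) d)
  weakening Γ⊆ (∀E d t)        = ∀E (weakening Γ⊆ d) t
  weakening Γ⊆ (∃I t d)        = ∃I t (weakening Γ⊆ d)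
  weakening Γ⊆ (∃E d e)        =
    ∃E (weakening Γ⊆ d) (weakening (∷⁺ʳ _ (map⁺ weaken Γ⊆)) e)
  weakening Γ⊆ (≐I t)          = ≐I t
  weakening Γ⊆ (≐E A d e)      = ≐E A (weakening Γ⊆ d) (weakening Γ⊆ e)
  weakening Γ⊆ (ω-general ds)  = ω-general (weakening Γ⊆ ∘ ds)
  weakening Γ⊆ (ω-integer ds)  = ω-integer (weakening Γ⊆ ∘ ds)

  Env : Ctx → Set
  Env = All ⟦_⟧ˢ

  ⌜_⌝ᵗ : ∀ {s} → ⟦ s ⟧ˢ → Term [] s
  ⌜_⌝ᵗ {general} = const
  ⌜_⌝ᵗ {integer} = num

  ⌜_⌝ : ∀ {Γ} → Env Γ → Tuple [] Γ
  ⌜_⌝ = All.map ⌜_⌝ᵗ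

  ⟦const⟧ : ∀ {Δ} r (η : Env Δ) → ⟦ const r ⟧ᵗ η ≡ r
  ⟦const⟧ (numeral n) η = refl
  ⟦const⟧ (other c)   η = refl

  infix 1 _⊢_
  -- Restricting to sentences lets every universal statement be proved at constants, so derivations
  -- with infinitely many premises never have to be closed under substitution.
  _⊢_ : List (Sentence σ₁) → Sentence σ₁ → Set
  Γ ⊢ A = Derivation HT#ω-Axiom ω Γ A

  cast : ∀ {Γ A B} → A ≡ B → Γ ⊢ A → Γ ⊢ B
  cast = subst (_ ⊢_)

  hyp₀ : ∀ {Γ A} → A ∷ Γ ⊢ A
  hyp₀ = hyp (here refl)

  wk₁ : ∀ {Γ A B} → Γ ⊢ A → B ∷ Γ ⊢ A
  wk₁ = weakening there

  cut : ∀ {Γ A C} → Γ ⊢ A → A ∷ Γ ⊢ C → Γ ⊢ C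
  cut d e = ⇒E (⇒I e) d

  ⊤I : ∀ {Γ} → Γ ⊢ ⊤ᶠ
  ⊤I = ⇒I hyp₀

  ∀ω : ∀ {Γ s} {A : Formula σ₁ (s ∷ [])} → (∀ a → Γ ⊢ A [ ⌜ a ⌝ᵗ ]₁) → Γ ⊢ ∀ᶠ A
  ∀ω {s = general} = ω-general
  ∀ω {s = integer} = ω-integer

  -- The calculus has no ω-rule for eliminating ∃. The ω-rule for ∀ first yields the universal
  -- closure of `A ⇒ weaken C`, which ordinary `∃E` then instantiates at its eigenvariable.
  ∃ω : ∀ {Γ s} {A : Formula σ₁ (s ∷ [])} {C} → Γ ⊢ ∃ᶠ A →
       (∀ a → A [ ⌜ a ⌝ᵗ ]₁ ∷ Γ ⊢ C) → Γ ⊢ C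
  ∃ω {A = A} {C} d e = cut (∀ω f) (∃E (wk₁ d) (⇒E (subst (Derivation _ _ _) substituted
    (∀E (hyp (there (here refl))) (var (here refl)))) (hyp (here refl))))
    where
    f : ∀ a → _ ⊢ (A ⇒ weaken C) [ ⌜ a ⌝ᵗ ]₁
    f a = ⇒I (cast (sym (weaken-[]₁ C ⌜ a ⌝ᵗ)) (e a))
    substituted : (A ⇒ weaken C) [ lift (vars there) ] [ var (here refl) ]₁ ≡ (A ⇒ weaken C)
    substituted = trans (lift-[]₁ (A ⇒ weaken C) (vars there) (var (here refl)))
                        ([]-id (A ⇒ weaken C))

  closureI : ∀ Δ {Γ} {A : Formula σ₁ Δ} → (∀ η → Γ ⊢ A [ ⌜ η ⌝ ]) → Γ ⊢ closure Δ A
  closureI []      {A = A} d = cast ([]-id A) (d [])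
  closureI (s ∷ Δ) {A = A} d = closureI Δ λ η → ∀ω λ a →
    cast (sym (lift-[]₁ A ⌜ η ⌝ ⌜ a ⌝ᵗ)) (d (a ∷ η))

  closureE : ∀ {Δ Γ} {A : Formula σ₁ Δ} → Γ ⊢ closure Δ A → (τ : Tuple [] Δ) → Γ ⊢ A [ τ ]
  closureE {A = A} d []      = cast (sym ([]-id A)) d
  closureE {A = A} d (t ∷ τ) = cast (lift-[]₁ A τ t) (∀E (closureE d τ) t)

  module _ {Δ : Ctx} (τ : Tuple [] Δ) where

    ∀*I : ∀ Θ {Γ} {A : Formula σ₁ (Θ ++ Δ)} →
          (∀ η → Γ ⊢ A [ ++⁺ ⌜ η ⌝ τ ]) → Γ ⊢ ∀* Θ A [ τ ]
    ∀*I []      d = d []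
    ∀*I (s ∷ Θ) {A = A} d = ∀*I Θ λ η → ∀ω λ a →
      cast (sym (lift-[]₁ A (++⁺ ⌜ η ⌝ τ) ⌜ a ⌝ᵗ)) (d (a ∷ η))

    ∀*E : ∀ {Θ Γ} {A : Formula σ₁ (Θ ++ Δ)} →
          Γ ⊢ ∀* Θ A [ τ ] → (υ : Tuple [] Θ) → Γ ⊢ A [ ++⁺ υ τ ]
    ∀*E d []      = d
    ∀*E {A = A} d (t ∷ υ) = cast (lift-[]₁ A (++⁺ υ τ) t) (∀E (∀*E d υ) t)

    ∃*I : ∀ {Θ Γ} {A : Formula σ₁ (Θ ++ Δ)} (υ : Tuple [] Θ) →
          Γ ⊢ A [ ++⁺ υ τ ] → Γ ⊢ ∃* Θ A [ τ ]
    ∃*I []      d = d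
    ∃*I {A = A} (t ∷ υ) d = ∃*I υ (∃I t (cast (sym (lift-[]₁ A (++⁺ υ τ) t)) d))

    -- Each eliminated quantifier adds a hypothesis, so the continuation has to accept every
    -- extension of `Γ`. The eliminations of `Atleast` and `Start` inherit this form.
    ∃*E : ∀ Θ {Γ C} {A : Formula σ₁ (Θ ++ Δ)} → Γ ⊢ ∃* Θ A [ τ ] →
          (∀ η {Γ′} → Γ ⊆ Γ′ → Γ′ ⊢ A [ ++⁺ ⌜ η ⌝ τ ] → Γ′ ⊢ C) → Γ ⊢ C
    ∃*E []      d e = e [] id d
    ∃*E (s ∷ Θ) {A = A} d e = ∃*E Θ d λ η Γ⊆ d′ → ∃ω d′ λ a →
      e (a ∷ η) (there ∘ Γ⊆) (cast (lift-[]₁ A (++⁺ ⌜ η ⌝ τ) ⌜ a ⌝ᵗ) hyp₀)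

  -- Comparisons of closed terms, settled by Std.

  stdI : ∀ {Γ} (S : Sentence σ∅) → True S → Γ ⊢ mapPred (σ∅⊆ {σ₁}) S
  stdI S p = cast ([]-id (mapPred (σ∅⊆ {σ₁}) S)) (axiom (common (std S p)))

  cmpI : ∀ {Γ c t u} → ⟦ c ⟧ᶜ (⟦ t ⟧ᵗ []) (⟦ u ⟧ᵗ []) → Γ ⊢ cmp c t u
  cmpI p = stdI (cmp _ _ _) p

  -- The negation of a false comparison is itself true in the standard interpretation, hence an
  -- instance of Std.
  cmpE : ∀ {Γ c t u C} → ¬ ⟦ c ⟧ᶜ (⟦ t ⟧ᵗ []) (⟦ u ⟧ᵗ []) → Γ ⊢ cmp c t u → Γ ⊢ C
  cmpE ¬p d = ⊥E (⇒E (stdI (¬ᶠ cmp _ _ _) ¬p) d)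

  const-cmpI : ∀ {Γ c r r′} → ⟦ c ⟧ᶜ r r′ → Γ ⊢ cmp c (const r) (const r′)
  const-cmpI {c = c} {r} {r′} p =
    cmpI (subst₂ ⟦ c ⟧ᶜ (sym (⟦const⟧ r [])) (sym (⟦const⟧ r′ [])) p)

  const-cmpE : ∀ {Γ c r r′ C} → ¬ ⟦ c ⟧ᶜ r r′ → Γ ⊢ cmp c (const r) (const r′) → Γ ⊢ C
  const-cmpE {c = c} {r} {r′} ¬p =
    cmpE (¬p ∘ subst₂ ⟦ c ⟧ᶜ (⟦const⟧ r []) (⟦const⟧ r′ []))

  -- Instances arise at terms such as `num n ⊕ num (+ 1)`, while the ω-rules concern numerals. The
  -- equation between terms of equal value is a true comparison, and `≐E` rewrites along it.
  replace : ∀ {Γ Δ s} (A : Formula σ₁ (s ∷ Δ)) {τ : Tuple [] Δ} {t u : Term [] s} →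
            ⟦ t ⟧ᵗ [] ≡ ⟦ u ⟧ᵗ [] → Γ ⊢ A [ t ∷ τ ] → Γ ⊢ A [ u ∷ τ ]
  replace {s = s} A {τ} {t} {u} e d = cast (lift-[]₁ A τ u)
    (≐E (A [ lift τ ]) (cmpI (asGeneral-≡ s e)) (cast (sym (lift-[]₁ A τ t)) d))
    where
    asGeneral-≡ : ∀ s {t u : Term [] s} → ⟦ t ⟧ᵗ [] ≡ ⟦ u ⟧ᵗ [] →
                  ⟦ asGeneral t ⟧ᵗ [] ≡ ⟦ asGeneral u ⟧ᵗ []
    asGeneral-≡ general e = e
    asGeneral-≡ integer e = cong numeral e

  substTerm-asGeneral : ∀ {Γ Δ} s (τ : Tuple Δ Γ) (t : Term Γ s) →
                        substTerm τ (asGeneral t) ≡ asGeneral (substTerm τ t)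
  substTerm-asGeneral general τ t = refl
  substTerm-asGeneral integer τ t = refl

  -- Soundness of the interpretation for the rules and the common axioms.

  module Soundness {σ : Signature} (θ : ∀ {ar} → σ ar → Formula σ₁ ar) where

    infix 8 _⟪_⟫
    _⟪_⟫ : ∀ {Δ} → Formula σ Δ → Tuple [] Δ → Sentence σ₁
    A ⟪ τ ⟫ = interpret θ A [ τ ]

    ⟪⟫-[] : ∀ {Γ Δ} (A : Formula σ Γ) (ρ : Tuple Δ Γ) (τ : Tuple [] Δ) →
            (A [ ρ ]) ⟪ τ ⟫ ≡ A ⟪ ρ ⨾ τ ⟫
    ⟪⟫-[] A ρ τ = trans (cong (_[ τ ]) (interpret-[] θ A ρ)) ([]-⨾ (interpret θ A) ρ τ)

    ⟪⟫-[]₁ : ∀ {Δ s} (A : Formula σ (s ∷ Δ)) (t : Term Δ s) (τ : Tuple [] Δ) →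
             (A [ t ]₁) ⟪ τ ⟫ ≡ interpret θ A [ lift τ ] [ substTerm τ t ]₁
    ⟪⟫-[]₁ A t τ = begin
      (A [ t ]₁) ⟪ τ ⟫                              ≡⟨ cong (_[ τ ]) (interpret-[] θ A _) ⟩
      interpret θ A [ t ]₁ [ τ ]                    ≡⟨ []₁-[] (interpret θ A) t τ ⟩
      A ⟪ substTerm τ t ∷ τ ⟫                       ≡⟨ lift-[]₁ (interpret θ A) τ _ ⟨
      interpret θ A [ lift τ ] [ substTerm τ t ]₁   ∎

    ⟪⟫-weaken : ∀ {Δ s} (A : Formula σ Δ) (t : Term [] s) (τ : Tuple [] Δ) →
                weaken A ⟪ t ∷ τ ⟫ ≡ A ⟪ τ ⟫
    ⟪⟫-weaken A t τ = trans (⟪⟫-[] A (vars there) _) (cong (A ⟪_⟫) (there-⨾ t τ))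

    map-⟪⟫-weaken : ∀ {Δ s} (Γ : List (Formula σ Δ)) (t : Term [] s) (τ : Tuple [] Δ) →
                    map (_⟪ t ∷ τ ⟫) (map weaken Γ) ≡ map (_⟪ τ ⟫) Γ
    map-⟪⟫-weaken Γ t τ =
      trans (sym (map-∘ Γ)) (map-cong (λ A → ⟪⟫-weaken A t τ) Γ)

    -- At `∀I` and `∃E` the induction hypothesis is used once for every constant put for the
    -- eigenvariable, which supplies the premises of an ω-rule. The hypotheses of the sequent are
    -- the same in all these premises, because weakened formulas ignore the added term.
    sound : ∀ {Ax : Axioms σ} →
            (∀ {Δ Γ} {A : Formula σ Δ} → Ax A → (τ : Tuple [] Δ) → Γ ⊢ A ⟪ τ ⟫) →
            ∀ {Δ Γ} {A : Formula σ Δ} → Derivation Ax finitary Γ A →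
            (τ : Tuple [] Δ) → map (_⟪ τ ⟫) Γ ⊢ A ⟪ τ ⟫
    sound ax (axiom a)    τ = ax a τ
    sound ax (hyp z)      τ = hyp (∈-map⁺ (_⟪ τ ⟫) z)
    sound ax (⊥E d)       τ = ⊥E (sound ax d τ)
    sound ax (∧I d e)     τ = ∧I (sound ax d τ) (sound ax e τ)
    sound ax (∧E₁ d)      τ = ∧E₁ (sound ax d τ)
    sound ax (∧E₂ d)      τ = ∧E₂ (sound ax d τ)
    sound ax (∨I₁ d)      τ = ∨I₁ (sound ax d τ)
    sound ax (∨I₂ d)      τ = ∨I₂ (sound ax d τ)
    sound ax (∨E d e f)   τ = ∨E (sound ax d τ) (sound ax e τ) (sound ax f τ)
    sound ax (⇒I d)       τ = ⇒I (sound ax d τ)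
    sound ax (⇒E d e)     τ = ⇒E (sound ax d τ) (sound ax e τ)
    sound ax {Γ = Γ} (∀I {A = A} d) τ = ∀ω λ a →
      subst₂ _⊢_ (map-⟪⟫-weaken Γ ⌜ a ⌝ᵗ τ) (sym (lift-[]₁ (interpret θ A) τ ⌜ a ⌝ᵗ))
        (sound ax d (⌜ a ⌝ᵗ ∷ τ))
    sound ax (∀E {A = A} d t) τ = cast (sym (⟪⟫-[]₁ A t τ)) (∀E (sound ax d τ) (substTerm τ t))
    sound ax (∃I {A = A} t d) τ = ∃I (substTerm τ t) (cast (⟪⟫-[]₁ A t τ) (sound ax d τ))
    sound ax {Γ = Γ} (∃E {A = A} {C} d e) τ = ∃ω (sound ax d τ) λ a →
      subst₂ _⊢_ (cong₂ _∷_ (sym (lift-[]₁ (interpret θ A) τ ⌜ a ⌝ᵗ)) (map-⟪⟫-weaken Γ ⌜ a ⌝ᵗ τ))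
        (⟪⟫-weaken C ⌜ a ⌝ᵗ τ) (sound ax e (⌜ a ⌝ᵗ ∷ τ))
    sound ax (≐I t)       τ = ≐I (substTerm τ t)
    sound ax (≐E {s = s} A {t} {u} d e) τ = cast (sym (⟪⟫-[]₁ A u τ))
      (≐E (interpret θ A [ lift τ ])
        (cast (cong₂ _≐_ (substTerm-asGeneral s τ t) (substTerm-asGeneral s τ u)) (sound ax d τ))
        (cast (⟪⟫-[]₁ A t τ) (sound ax e τ)))

    common-sound : ∀ {Δ Γ} {A : Formula σ Δ} → CommonAxiom A →
                   (τ : Tuple [] Δ) → Γ ⊢ A ⟪ τ ⟫
    common-sound (hosoi F G) τ = axiom (common (hosoi (F ⟪ τ ⟫) (G ⟪ τ ⟫)))
    common-sound (sqht F)    τ =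
      cast (cong (λ B → ∃ᶠ (F′ [ lift τ ] ⇒ B)) (sym weaken-∀F))
        (axiom (common (sqht (F′ [ lift τ ]))))
      where
      F′ = interpret θ F
      weaken-∀F : interpret θ (weaken (∀ᶠ F)) [ lift τ ] ≡ weaken (∀ᶠ F′ [ τ ])
      weaken-∀F = trans (cong (_[ lift τ ]) (interpret-[] θ (∀ᶠ F) (vars there)))
                        (weaken-lift (∀ᶠ F′) τ)
    common-sound (std S p)   τ =
      cast (sym (trans (⟪⟫-[] (mapPred (σ∅⊆ {σ}) S) [] τ)
                       (cong (_[ [] ])
                         (interpret-mapPred θ {f = σ∅⊆ {σ}} {g = σ∅⊆ {σ₁}} (λ ()) S))))
           (axiom (common (std S p)))

  module _ (θ : ∀ {ar} → σ₂ ar → Formula σ₁ ar) where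
    open Soundness θ

    -- The instance at a natural number k is reached from the base case by k uses of the induction
    -- step, and the ω-rule collects the instances. At a negative integer the guard `N≥0` is
    -- refuted.
    induction-sound : ∀ {Δ Γ} (F : Formula σ₂ (integer ∷ Δ)) (τ : Tuple [] Δ) →
                      Γ ⊢ induction F ⟪ τ ⟫
    induction-sound {Δ} {Γ} F τ =
      ⇒I (∀ω λ n → cast (sym (lift-[]₁ (N≥0 ⇒ F′) τ (num n))) (⇒I (at n)))
      where
      N : Term (integer ∷ Δ) integer
      N = var (here refl)
      N≥0 : ∀ {σ} → Formula σ (integer ∷ Δ)
      N≥0 = cmp ge (↑ N) (↑ num (+ 0))
      next : Formula σ₂ (integer ∷ Δ)
      next = F [ N ⊕ num (+ 1) ∷ vars there ]
      F′ : Formula σ₁ (integer ∷ Δ)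
      F′ = interpret θ F

      Γ⁺ : List (Sentence σ₁)
      Γ⁺ = ((F [ num (+ 0) ]₁) ∧ ∀ᶠ (N≥0 ∧ F ⇒ next)) ⟪ τ ⟫ ∷ Γ

      step : ∀ n → Γ⁺ ⊢ (N≥0 ∧ F ⇒ next) ⟪ num n ∷ τ ⟫
      step n = cast (lift-[]₁ (interpret θ (N≥0 ∧ F ⇒ next)) τ (num n)) (∀E (∧E₂ hyp₀) (num n))

      next-≡ : ∀ n → next ⟪ num n ∷ τ ⟫ ≡ F′ [ num n ⊕ num (+ 1) ∷ τ ]
      next-≡ n = trans (⟪⟫-[] F (N ⊕ num (+ 1) ∷ vars there) (num n ∷ τ))
        (cong (λ υ → F ⟪ num n ⊕ num (+ 1) ∷ υ ⟫) (there-⨾ (num n) τ))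

      at-+ : ∀ k → Γ⁺ ⊢ F′ [ num (+ k) ∷ τ ]
      at-+ 0       = cast (trans (⟪⟫-[]₁ F _ τ) (lift-[]₁ F′ τ _)) (∧E₁ hyp₀)
      -- The step ends at `num (+ k) ⊕ num (+ 1)`, whose value computes to k + 1 rather than to
      -- `suc k`.
      at-+ (suc k) = replace F′ (cong +_ (ℕ.+-comm k 1)) (cast (next-≡ (+ k))
        (⇒E (step (+ k)) (∧I (cmpI (numeral≥0 k)) (at-+ k))))
        where
        numeral≥0 : ∀ k → ⟦ ge ⟧ᶜ (numeral (+ k)) (numeral (+ 0))
        numeral≥0 0       = inj₂ refl
        numeral≥0 (suc k) = inj₁ (numeral-mono (ℤ.+<+ (s≤s z≤n)))

      at : ∀ n → N≥0 [ num n ∷ τ ] ∷ Γ⁺ ⊢ F′ [ num n ∷ τ ]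
      at (+ k)    = wk₁ (at-+ k)
      at -[1+ k ] = cmpE negative hyp₀
        where
        negative : ¬ ⟦ ge ⟧ᶜ (numeral -[1+ k ]) (numeral (+ 0))
        negative (inj₁ 0≺n) = ≺-asym 0≺n (numeral-mono ℤ.-<+)
        negative (inj₂ ())

  -- Numerals and other precomputed terms in the total order.

  numeral-cancel-≺ : ∀ {m n} → numeral m ≺ numeral n → m ℤ.< n
  numeral-cancel-≺ {m} {n} m≺n with ℤ.<-cmp m n
  ... | tri< m<n _ _ = m<n
  ... | tri≈ _ refl _ = ⊥-elim (≺-irrefl refl m≺n)
  ... | tri> _ _ n<m = ⊥-elim (≺-asym m≺n (numeral-mono n<m))

  numeral-≮⇒≥ : ∀ {m n} → ¬ numeral m ≺ numeral n → n ℤ.≤ m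
  numeral-≮⇒≥ m⊀n = ℤ.≮⇒≥ (m⊀n ∘ numeral-mono)

  numeral-mono-≤ : ∀ {m n} → m ℤ.≤ n → ⟦ le ⟧ᶜ (numeral m) (numeral n)
  numeral-mono-≤ {m} {n} m≤n with ℤ.<-cmp m n
  ... | tri< m<n _ _  = inj₁ (numeral-mono m<n)
  ... | tri≈ _ refl _ = inj₂ refl
  ... | tri> _ _ n<m  = ⊥-elim (ℤ.<⇒≱ n<m m≤n)

  numeral-cancel-≼ : ∀ {m n} → ⟦ le ⟧ᶜ (numeral m) (numeral n) → m ℤ.≤ n
  numeral-cancel-≼ (inj₁ m≺n)  = ℤ.<⇒≤ (numeral-cancel-≺ m≺n)
  numeral-cancel-≼ (inj₂ refl) = ℤ.≤-refl

  other-⊀⇒≻ : ∀ {c n} → ¬ other c ≺ numeral n → numeral n ≺ other c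
  other-⊀⇒≻ {c} {n} c⊀n with compare (other c) (numeral n)
  ... | tri< c≺n _ _ = ⊥-elim (c⊀n c≺n)
  ... | tri> _ _ n≺c = n≺c

  -- By contiguity, a term lying between two numerals would be a numeral.
  other-not-between : ∀ {m n c} → numeral m ≺ other c → ¬ other c ≺ numeral n
  other-not-between m≺c c≺n with contiguous m≺c c≺n
  ... | _ , ()

  other-above : ∀ {m n c} → numeral m ≺ other c → numeral n ≺ other c
  other-above {n = n} {c} m≺c = other-⊀⇒≻ (other-not-between m≺c)

  -- Lexicographic order on tuples of values, inside and outside the calculus.

  Values : ℕ → Set
  Values n = Env (generals n)

  -- The semantic counterpart of `_<*_`. It is empty for n = 0, so an increasing list of 0-tuples
  -- has at most one entry.
  Lex : ∀ n → Rel (Values n) 0ℓ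
  Lex 0       []       []       = ⊥
  Lex (suc n) (a ∷ as) (b ∷ bs) = a ≺ b ⊎ a ≡ b × Lex n as bs

  Lex-trans : ∀ n → Transitive (Lex n)
  Lex-trans 0       {[]}    {[]}    {[]} ()
  Lex-trans (suc n) {_ ∷ _} {_ ∷ _} {_ ∷ _} (inj₁ p)          (inj₁ q)          = inj₁ (≺-trans p q)
  Lex-trans (suc n) {_ ∷ _} {_ ∷ _} {_ ∷ _} (inj₁ p)          (inj₂ (refl , _)) = inj₁ p
  Lex-trans (suc n) {_ ∷ _} {_ ∷ _} {_ ∷ _} (inj₂ (refl , _)) (inj₁ q)          = inj₁ q
  Lex-trans (suc n) {_ ∷ _} {_ ∷ _} {_ ∷ _} (inj₂ (refl , p)) (inj₂ (refl , q)) =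
    inj₂ (refl , Lex-trans n p q)

  Lex-compare : ∀ n → Trichotomous _≡_ (Lex n)
  Lex-compare 0       []       []       = tri≈ (λ ()) refl (λ ())
  Lex-compare (suc n) (a ∷ as) (b ∷ bs) with compare a b
  ... | tri< a≺b a≢b a⊁b =
    tri< (inj₁ a≺b) (λ { refl → a≢b refl })
         (λ { (inj₁ p) → a⊁b p ; (inj₂ (e , _)) → a≢b (sym e) })
  ... | tri> a⊀b a≢b a≻b =
    tri> (λ { (inj₁ p) → a⊀b p ; (inj₂ (e , _)) → a≢b e }) (λ { refl → a≢b refl }) (inj₁ a≻b)
  ... | tri≈ _ refl _ with Lex-compare n as bs
  ...   | tri< p q r = tri< (inj₂ (refl , p)) (λ { refl → q refl })
                            (λ { (inj₁ i) → ≺-irrefl refl i ; (inj₂ (_ , i)) → r i })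
  ...   | tri≈ p refl r = tri≈ (λ { (inj₁ i) → ≺-irrefl refl i ; (inj₂ (_ , i)) → p i }) refl
                               (λ { (inj₁ i) → ≺-irrefl refl i ; (inj₂ (_ , i)) → r i })
  ...   | tri> p q r = tri> (λ { (inj₁ i) → ≺-irrefl refl i ; (inj₂ (_ , i)) → p i })
                            (λ { refl → q refl }) (inj₂ (refl , r))

  Lex-irrefl : ∀ n {X Y} → Lex n X Y → X ≢ Y
  Lex-irrefl n {X} p refl with Lex-compare n X X
  ... | tri< _ X≢X _ = X≢X refl
  ... | tri≈ ¬p _ _  = ¬p p
  ... | tri> _ X≢X _ = X≢X refl

  module _ {σ : Signature} where

    ≐*-[] : ∀ n {Γ Δ} (X Y : Tuple Γ (generals n)) (τ : Tuple Δ Γ) →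
            _≐*_ {σ} {n = n} X Y [ τ ] ≡ _≐*_ {n = n} (X ⨾ τ) (Y ⨾ τ)
    ≐*-[] 0       []      []      τ = refl
    ≐*-[] (suc n) (_ ∷ X) (_ ∷ Y) τ = cong (_ ∧_) (≐*-[] n X Y τ)

    <*-[] : ∀ n {Γ Δ} (X Y : Tuple Γ (generals n)) (τ : Tuple Δ Γ) →
            _<*_ {σ} {n = n} X Y [ τ ] ≡ _<*_ {n = n} (X ⨾ τ) (Y ⨾ τ)
    <*-[] 0       []      []      τ = refl
    <*-[] (suc n) (_ ∷ X) (_ ∷ Y) τ = cong (λ A → _ ∨ (_ ∧ A)) (<*-[] n X Y τ)

  interpret-<* : ∀ {σ σ′ : Signature} (θ : ∀ {ar} → σ ar → Formula σ′ ar)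
                 n {Γ} (X Y : Tuple Γ (generals n)) →
                 interpret θ (_<*_ {n = n} X Y) ≡ _<*_ {n = n} X Y
  interpret-<* θ 0       []      []      = refl
  interpret-<* θ (suc n) (_ ∷ X) (_ ∷ Y) = cong (λ A → _ ∨ (_ ∧ A)) (interpret-<* θ n X Y)

  mapPred-<* : ∀ {σ σ′ : Signature} (f : ∀ {ar} → σ ar → σ′ ar)
               n {Γ} (X Y : Tuple Γ (generals n)) →
               mapPred {σ} {σ′} f (_<*_ {n = n} X Y) ≡ _<*_ {n = n} X Y
  mapPred-<* f 0       []      []      = refl
  mapPred-<* {σ} {σ′} f (suc n) (_ ∷ X) (_ ∷ Y) =
    cong (λ A → _ ∨ (_ ∧ A)) (mapPred-<* {σ} {σ′} f n X Y)

  ≐*I : ∀ n {Γ} (X : Values n) → Γ ⊢ _≐*_ {n = n} ⌜ X ⌝ ⌜ X ⌝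
  ≐*I 0       []      = ⊤I
  ≐*I (suc n) (a ∷ X) = ∧I (≐I (const a)) (≐*I n X)

  -- Distinctness of two tuples does not name a coordinate at which they differ. Comparison from the
  -- left finds one, and Std refutes the equation there.
  ≐*E : ∀ n {Γ C} (X Y : Values n) → X ≢ Y → Γ ⊢ _≐*_ {n = n} ⌜ X ⌝ ⌜ Y ⌝ → Γ ⊢ C
  ≐*E 0       []      []      X≢Y d = ⊥-elim (X≢Y refl)
  ≐*E (suc n) (a ∷ X) (b ∷ Y) X≢Y d with compare a b
  ... | tri< _ a≢b _  = const-cmpE a≢b (∧E₁ d)
  ... | tri≈ _ refl _ = ≐*E n X Y (X≢Y ∘ cong (a ∷_)) (∧E₂ d)
  ... | tri> _ a≢b _  = const-cmpE a≢b (∧E₁ d)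

  <*I : ∀ n {Γ} (X Y : Values n) → Lex n X Y → Γ ⊢ _<*_ {n = n} ⌜ X ⌝ ⌜ Y ⌝
  <*I 0       []      []      ()
  <*I (suc n) (a ∷ X) (b ∷ Y) (inj₁ a≺b)        = ∨I₁ (const-cmpI a≺b)
  <*I (suc n) (a ∷ X) (b ∷ Y) (inj₂ (refl , p)) = ∨I₂ (∧I (≐I (const a)) (<*I n X Y p))

  <*E : ∀ n {Γ C} (X Y : Values n) → ¬ Lex n X Y → Γ ⊢ _<*_ {n = n} ⌜ X ⌝ ⌜ Y ⌝ → Γ ⊢ C
  <*E 0       []      []      ¬p d = ⊥E d
  <*E (suc n) (a ∷ X) (b ∷ Y) ¬p d with compare a b
  ... | tri< a≺b _ _ = ⊥-elim (¬p (inj₁ a≺b))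
  ... | tri≈ a⊀b refl _ =
    ∨E d (const-cmpE a⊀b hyp₀) (<*E n X Y (λ p → ¬p (inj₂ (refl , p))) (∧E₂ hyp₀))
  ... | tri> a⊀b a≢b _ = ∨E d (const-cmpE a⊀b hyp₀) (const-cmpE a≢b (∧E₁ hyp₀))

  -- Finite conjunctions and disjunctions, also over pairs.

  module _ {Γ : List (Sentence σ₁)} {Δ : Ctx} {τ : Tuple [] Δ} where

    ⋀I : ∀ {As : List (Formula σ₁ Δ)} → All (λ A → Γ ⊢ A [ τ ]) As → Γ ⊢ ⋀ As [ τ ]
    ⋀I []       = ⊤I
    ⋀I (d ∷ ds) = ∧I d (⋀I ds)

    ⋀E : ∀ {As : List (Formula σ₁ Δ)} → Γ ⊢ ⋀ As [ τ ] → All (λ A → Γ ⊢ A [ τ ]) As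
    ⋀E {[]}     d = []
    ⋀E {_ ∷ As} d = ∧E₁ d ∷ ⋀E (∧E₂ d)

    ⋁I : ∀ {As : List (Formula σ₁ Δ)} → Any (λ A → Γ ⊢ A [ τ ]) As → Γ ⊢ ⋁ As [ τ ]
    ⋁I (here d)  = ∨I₁ d
    ⋁I (there d) = ∨I₂ (⋁I d)

  ⋁E : ∀ {Γ Δ C} {τ : Tuple [] Δ} {As : List (Formula σ₁ Δ)} →
       All (λ A → Γ ⊢ ¬ᶠ A [ τ ]) As → Γ ⊢ ⋁ As [ τ ] → Γ ⊢ C
  ⋁E []       d = ⊥E d
  ⋁E (e ∷ es) d = ∨E d (⊥E (⇒E (wk₁ e) hyp₀)) (⋁E (All.map wk₁ es) hyp₀)

  module _ {A : Set} {R : Rel A 0ℓ} where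

    pairs⁺ : ∀ {xs} → AllPairs R xs → All (uncurry R) (pairs xs)
    pairs⁺ []       = []
    pairs⁺ (p ∷ ps) = ++⁺ (All.map⁺ p) (pairs⁺ ps)

    pairs⁻ : ∀ {xs} → All (uncurry R) (pairs xs) → AllPairs R xs
    pairs⁻ {[]}     ps = []
    pairs⁻ {x ∷ xs} ps =
      All.map⁻ (All.++⁻ˡ (map (x ,_) xs) ps) ∷ pairs⁻ (All.++⁻ʳ (map (x ,_) xs) ps)

  pairs-map : ∀ {A B : Set} (f : A → B) (xs : List A) →
              pairs (map f xs) ≡ map (λ (x , y) → f x , f y) (pairs xs)
  pairs-map f []       = refl
  pairs-map f (x ∷ xs) = begin
    map (f x ,_) (map f xs) ++ pairs (map f xs)
      ≡⟨ cong₂ _++_ (trans (sym (map-∘ xs)) (map-∘ xs)) (pairs-map f xs) ⟩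
    map (λ (x , y) → f x , f y) (map (x ,_) xs) ++ map (λ (x , y) → f x , f y) (pairs xs)
      ≡⟨ map-++ᴸ _ (map (x ,_) xs) (pairs xs) ⟨
    map (λ (x , y) → f x , f y) (pairs (x ∷ xs)) ∎

  -- The counting quantifiers in terms of increasing chains.

  module Chains {Δ : Ctx} (x : ℕ) (A : Formula σ₁ (generals x ++ Δ)) (τ : Tuple [] Δ) where
    open Counting x A
    open Sorting {_<_ = Lex x} (Lex-trans x) (Lex-compare x)

    Φ : Values x → Sentence σ₁
    Φ X = A [ ++⁺ ⌜ X ⌝ τ ]

    -- The two fields live on different levels: the order is a fact about concrete values, but
    -- satisfaction is only derivability from `Γ`. Increasing rather than merely distinct entries
    -- are recorded because `Start` speaks of increasing sequences.
    record Chain (Γ : List (Sentence σ₁)) (Y : List (Values x)) : Set where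
      constructor chain
      field
        increasing : AllPairs (Lex x) Y
        satisfying : All (λ X → Γ ⊢ Φ X) Y

    take-Chain : ∀ {Γ Y} n → Chain Γ Y → Chain Γ (take n Y)
    take-Chain n (chain p q) = chain (AllPairs.take⁺ n p) (All.take⁺ n q)

    row : ∀ n → Env (block n) → Fin n → Values x
    row n η i = All.tabulate (All.lookup η ∘ inBlock i)

    rows : ∀ n → Env (block n) → List (Values x)
    rows n η = map (row n η) (allFin n)

    -- The witness for a quantifier block. Indexing it by `length Y` avoids transports here; the
    -- equation of lengths is used once in `∃≥I` and once in `∃≤E`.
    flatten : (Y : List (Values x)) → Env (block (length Y))
    flatten []      = []
    flatten (X ∷ Y) = ++⁺ X (flatten Y)

    row-flatten : ∀ Y i → row (length Y) (flatten Y) i ≡ lookup Y i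
    row-flatten (X ∷ Y) zero    = All-ext λ z →
      trans (lookup-tabulate _ z) (lookup-++ˡ X (flatten Y) z)
    row-flatten (X ∷ Y) (suc i) = trans
      (All-ext λ z → trans (lookup-tabulate _ z) (trans
        (lookup-++ʳ X (flatten Y) (inBlock i z)) (sym (lookup-tabulate _ z))))
      (row-flatten Y i)

    rows-flatten : ∀ Y → rows (length Y) (flatten Y) ≡ Y
    rows-flatten Y = trans (map-tabulateᴸ id (row (length Y) (flatten Y)))
      (trans (tabulate-cong (row-flatten Y)) (tabulate-lookup Y))

    all-distinct some-equal : ∀ n → Formula σ₁ (block n ++ Δ)
    all-distinct n = ⋀ (map (λ (X , X′) → ¬ᶠ (_≐*_ {n = x} X X′)) (pairs (copies n)))
    some-equal   n = ⋁ (map (λ (X , X′) → _≐*_ {n = x} X X′) (pairs (copies n)))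

    module _ (n : ℕ) (η : Env (block n)) where

      copy : Fin n → Tuple (block n ++ Δ) (generals x)
      copy i = vars (∈-++⁺ˡ ∘ inBlock i)

      υ : Tuple [] (block n ++ Δ)
      υ = ++⁺ ⌜ η ⌝ τ

      copy-⨾ : ∀ i → copy i ⨾ υ ≡ ⌜ row n η i ⌝
      copy-⨾ i = vars-⨾-≡ λ z → trans (lookup-++ˡ ⌜ η ⌝ τ (inBlock i z))
        (trans (lookup-map η (inBlock i z))
          (sym (trans (lookup-map (row n η i) z) (cong ⌜_⌝ᵗ (lookup-tabulate _ z)))))

      F-copy : ∀ i → A [ ++⁺ (copy i) (vars (∈-++⁺ʳ (block n))) ] [ υ ] ≡ Φ (row n η i)
      F-copy i = trans ([]-⨾ A _ υ) (cong (A [_]) (trans (map-++ (copy i) _)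
        (cong₂ ++⁺ (copy-⨾ i) (vars-⨾-≡ (lookup-++ʳ ⌜ η ⌝ τ)))))

      equal : Fin n → Fin n → Formula σ₁ (block n ++ Δ)
      equal i j = _≐*_ {n = x} (copy i) (copy j)

      ≐-copies : ∀ i j → equal i j [ υ ] ≡ _≐*_ {n = x} ⌜ row n η i ⌝ ⌜ row n η j ⌝
      ≐-copies i j = trans (≐*-[] x (copy i) (copy j) υ)
        (cong₂ (_≐*_ {n = x}) (copy-⨾ i) (copy-⨾ j))

      all-FI : ∀ {Γ} → All (λ X → Γ ⊢ Φ X) (rows n η) → Γ ⊢ all-F n [ υ ]
      all-FI ds = ⋀I (All.map⁺ (All.map⁺ (All.map (λ {i} → cast (sym (F-copy i))) (All.map⁻ ds))))

      all-FE : ∀ {Γ} → Γ ⊢ all-F n [ υ ] → All (λ X → Γ ⊢ Φ X) (rows n η)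
      all-FE d = All.map⁺ (All.map (λ {i} → cast (F-copy i)) (All.map⁻ (All.map⁻ (⋀E d))))

      unequal : ∀ {Γ} → AllPairs _≢_ (rows n η) →
                All (λ (X , X′) → Γ ⊢ ¬ᶠ (_≐*_ {n = x} X X′ [ υ ])) (pairs (copies n))
      unequal {Γ} ≢s =
        pairs⁺ (AllPairs.map⁺ (AllPairs.map (λ {i} {j} → f {i} {j}) (AllPairs.map⁻ ≢s)))
        where
        f : ∀ {i j} → row n η i ≢ row n η j → Γ ⊢ ¬ᶠ (equal i j [ υ ])
        f {i} {j} i≢j = ⇒I (≐*E x _ _ i≢j (cast (≐-copies i j) hyp₀))

      all-distinctI : ∀ {Γ} → AllPairs _≢_ (rows n η) → Γ ⊢ all-distinct n [ υ ]
      all-distinctI ≢s = ⋀I (All.map⁺ (unequal ≢s))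

      some-equalE : ∀ {Γ C} → AllPairs _≢_ (rows n η) → Γ ⊢ some-equal n [ υ ] → Γ ⊢ C
      some-equalE ≢s = ⋁E (All.map⁺ (unequal ≢s))

      Repetition : Set
      Repetition = Any (uncurry (_≡_ on row n η)) (pairs (allFin n))

      -- Equality of tuples is decidable by trichotomy. Distinct rows can be sorted into a chain,
      -- while a repetition proves `some-equal` and refutes `all-distinct`.
      distinct? : AllPairs _≢_ (rows n η) ⊎ Repetition
      distinct? with Any.any? (λ (i , j) → tri⇒dec≈ (Lex-compare x) (row n η i) (row n η j))
                              (pairs (allFin n))
      ... | yes p = inj₂ p
      ... | no ¬p = inj₁ (AllPairs.map⁺ (pairs⁻ (¬Any⇒All¬ _ ¬p)))

      equalI : ∀ {Γ i j} → row n η i ≡ row n η j → Γ ⊢ equal i j [ υ ]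
      equalI {i = i} {j} e = cast (trans (cong (λ Z → _≐*_ {n = x} ⌜ row n η i ⌝ ⌜ Z ⌝) e)
        (sym (≐-copies i j))) (≐*I x (row n η i))

      some-equalI : ∀ {Γ} → Repetition → Γ ⊢ some-equal n [ υ ]
      some-equalI {Γ} e = ⋁I (Any.map⁺ (subst (Any (λ (X , X′) → Γ ⊢ _≐*_ {n = x} X X′ [ υ ]))
        (sym (pairs-map copy (allFin n)))
        (Any.map⁺ (Any.map (λ {(i , j)} → equalI {i = i} {j}) e))))

      all-distinctE : ∀ {Γ} → Repetition → Γ ⊢ all-distinct n [ υ ] → Γ ⊢ ⊥ᶠ
      all-distinctE {Γ} e d = All.lookupWith {R = λ _ → Γ ⊢ ⊥ᶠ}
        (λ {(i , j)} ¬eq i≡j → ⇒E ¬eq (equalI {i = i} {j} i≡j)) (pairs⁺ refuted) e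
        where
        refuted : AllPairs (λ i j → Γ ⊢ ¬ᶠ (equal i j [ υ ])) (allFin n)
        refuted = AllPairs.map⁻ {f = copy} (pairs⁻ {R = λ X X′ → Γ ⊢ ¬ᶠ (_≐*_ {n = x} X X′ [ υ ])}
          (All.map⁻ (⋀E d)))

      -- Derivability of `Φ` is a condition on each row separately, so it survives the permutation.
      sort-rows : ∀ {Γ} → All (λ X → Γ ⊢ Φ X) (rows n η) → AllPairs _≢_ (rows n η) →
                  ∃[ Y ] Chain Γ Y × length Y ≡ n
      sort-rows ds ≢s with sort ≢s
      ... | Y , s , p = Y , chain s (All-resp-↭ (↭-sym p) ds) ,
                        trans (↭-length p) (trans (length-map _ (allFin n)) (length-tabulate id))

    -- The bound compares precomputed terms because `r` need not be a numeral.
    ∃≥I : ∀ {Γ} r {Y} → Chain Γ Y → ¬ numeral (+ length Y) ≺ r → Γ ⊢ ∃≥ r [ τ ]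
    ∃≥I (numeral (+ 0))      Y p = ⊤I
    ∃≥I (numeral -[1+ _ ])   Y p = ⊤I
    ∃≥I {Γ} (numeral (+ suc k)) {Y} Y-chain p =
      -- The chain may be too long for the formula, which asks for exactly `suc k` tuples; a prefix
      -- is used.
      subst (λ n → Γ ⊢ ∃* (block n) (all-F n ∧ all-distinct n) [ τ ])
        (trans (length-take (suc k) Y) (ℕ.m≤n⇒m⊓n≡m (ℤ.drop‿+≤+ (numeral-≮⇒≥ p))))
        (at-length (take-Chain (suc k) Y-chain))
      where
      at-length : ∀ {Z} → Chain Γ Z → let n = length Z in
        Γ ⊢ ∃* (block n) (all-F n ∧ all-distinct n) [ τ ]
      at-length {Z} (chain inc sat) = ∃*I τ ⌜ flatten Z ⌝ (∧I
        (all-FI (length Z) (flatten Z) (subst (All _) (sym (rows-flatten Z)) sat))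
        (all-distinctI (length Z) (flatten Z) (subst (AllPairs _≢_) (sym (rows-flatten Z))
          (AllPairs.map (Lex-irrefl x) inc))))
    ∃≥I (other c) Y p with other c <? numeral (+ 0)
    ... | yes _   = ⊤I
    -- A non-numeral above 0 is above every numeral, so no chain is long enough.
    ... | no  c⊀0 = ⊥-elim (p (other-above (other-⊀⇒≻ c⊀0)))

    ∃≥E : ∀ {Γ C} r → Γ ⊢ ∃≥ r [ τ ] →
          (∀ {Γ′} Y → Γ ⊆ Γ′ → Chain Γ′ Y → ¬ numeral (+ length Y) ≺ r → Γ′ ⊢ C) → Γ ⊢ C
    -- For `r` not above 0 the formula carries no information, and the empty chain is already long
    -- enough.
    ∃≥E (numeral (+ 0))     d e = e [] id (chain [] []) (≺-irrefl refl)
    ∃≥E (numeral -[1+ _ ])  d e = e [] id (chain [] []) λ p → ≺-asym p (numeral-mono ℤ.-<+)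
    ∃≥E {Γ} {C} (numeral (+ suc k)) d e = ∃*E τ (block (suc k)) d f
      where
      f : ∀ η {Γ′} → Γ ⊆ Γ′ → Γ′ ⊢ (all-F (suc k) ∧ all-distinct (suc k)) [ ++⁺ ⌜ η ⌝ τ ] → Γ′ ⊢ C
      f η Γ⊆ d′ with distinct? (suc k) η
      ... | inj₂ i = ⊥E (all-distinctE (suc k) η i (∧E₂ d′))
      ... | inj₁ ≢s with sort-rows (suc k) η (all-FE (suc k) η (∧E₁ d′)) ≢s
      ...   | Y , Y-chain , l = e Y Γ⊆ Y-chain (≺-irrefl (cong (numeral ∘ +_) l))
    ∃≥E (other c) d e with other c <? numeral (+ 0)
    ... | yes c≺0 = e [] id (chain [] []) (≺-asym c≺0)
    ... | no  _   = ⊥E d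

    -- An upper bound is proved by refuting every longer chain. The refutation must work in larger
    -- contexts, since the rows of such a chain satisfy the formula only by hypothesis.
    ∃≤I : ∀ {Γ} r → (∀ {Γ′} Y → Γ ⊆ Γ′ → Chain Γ′ Y → r ≺ numeral (+ length Y) → Γ′ ⊢ ⊥ᶠ) →
          Γ ⊢ ∃≤ r [ τ ]
    ∃≤I {Γ} (numeral (+ n)) e = ∀*I τ (block (suc n)) f
      where
      f : ∀ η → Γ ⊢ (all-F (suc n) ⇒ some-equal (suc n)) [ ++⁺ ⌜ η ⌝ τ ]
      f η with distinct? (suc n) η
      ... | inj₂ i  = ⇒I (some-equalI (suc n) η i)
      ... | inj₁ ≢s with sort-rows (suc n) η (all-FE (suc n) η hyp₀) ≢s
      ...   | Y , Y-chain , l =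
        ⇒I (⊥E (e Y there Y-chain (numeral-mono (ℤ.+<+ (ℕ.≤-reflexive (sym l))))))
    -- Here the formula is `⊥ᶠ`, and the empty chain already exceeds the bound.
    ∃≤I (numeral -[1+ _ ]) e = e [] id (chain [] []) (numeral-mono ℤ.-<+)
    ∃≤I (other c)          e with other c <? numeral (+ 0)
    ... | yes c≺0 = e [] id (chain [] []) c≺0
    ... | no  _   = ⊤I

    -- For a numeral n ≥ 0, the first n + 1 entries are pairwise distinct, so each disjunct of
    -- `some-equal` is refuted.
    ∃≤E : ∀ {Γ} r {Y} → Γ ⊢ ∃≤ r [ τ ] → Chain Γ Y → r ≺ numeral (+ length Y) → Γ ⊢ ⊥ᶠ
    ∃≤E {Γ} (numeral (+ n)) {Y} d Y-chain p = at-length (take-Chain (suc n) Y-chain)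
      (trans (length-take (suc n) Y) (ℕ.m≤n⇒m⊓n≡m (ℤ.drop‿+<+ (numeral-cancel-≺ p)))) d
      where
      at-length : ∀ {Z m} → Chain Γ Z → length Z ≡ m →
                  Γ ⊢ ∀* (block m) (all-F m ⇒ some-equal m) [ τ ] → Γ ⊢ ⊥ᶠ
      at-length {Z} (chain inc sat) refl d = some-equalE (length Z) (flatten Z)
        (subst (AllPairs _≢_) (sym (rows-flatten Z)) (AllPairs.map (Lex-irrefl x) inc))
        (⇒E (∀*E τ d ⌜ flatten Z ⌝)
          (all-FI (length Z) (flatten Z) (subst (All _) (sym (rows-flatten Z)) sat)))
    ∃≤E (numeral -[1+ _ ]) d Y-chain p = d
    ∃≤E (other c)          d Y-chain p with other c <? numeral (+ 0)
    ... | yes _   = d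
    ... | no  c⊀0 = ⊥-elim (other-not-between (other-⊀⇒≻ c⊀0) p)

  mapPred-[] : ∀ {σ σ′ : Signature} (f : ∀ {ar} → σ ar → σ′ ar) {Γ Δ}
               (A : Formula σ Γ) (τ : Tuple Δ Γ) →
               mapPred f (A [ τ ]) ≡ mapPred f A [ τ ]
  mapPred-[] f (pred p ts) τ = refl
  mapPred-[] f (cmp c t u) τ = refl
  mapPred-[] f ⊥ᶠ          τ = refl
  mapPred-[] f (A ∧ B)     τ = cong₂ _∧_ (mapPred-[] f A τ) (mapPred-[] f B τ)
  mapPred-[] f (A ∨ B)     τ = cong₂ _∨_ (mapPred-[] f A τ) (mapPred-[] f B τ)
  mapPred-[] f (A ⇒ B)     τ = cong₂ _⇒_ (mapPred-[] f A τ) (mapPred-[] f B τ)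
  mapPred-[] f (∀ᶠ A)      τ = cong ∀ᶠ (mapPred-[] f A (lift τ))
  mapPred-[] f (∃ᶠ A)      τ = cong ∃ᶠ (mapPred-[] f A (lift τ))

  substTerm-const : ∀ {Γ Δ} (τ : Tuple Δ Γ) r → substTerm τ (const r) ≡ const r
  substTerm-const τ (numeral n) = refl
  substTerm-const τ (other c)   = refl

  -- `Atleast` and `Atmost` in terms of chains.

  module Counts (x v : ℕ) (F : Formula σ₀ (generals x ++ generals v)) (a : Values v) where
    private
      F₁ : Formula σ₁ (generals x ++ generals v)
      F₁ = mapPred base F
    open Chains x F₁ ⌜ a ⌝ using (∃≥I; ∃≥E; ∃≤I; ∃≤E)
    open Chains x F₁ ⌜ a ⌝ public using (Φ; Chain; chain)

    vars-const-⨾ : ∀ r → (++⁺ (vars id) (const r ∷ [])) ⨾ ⌜ a ⌝ ≡ ++⁺ ⌜ a ⌝ (const r ∷ [])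
    vars-const-⨾ r = trans (map-++ (vars id) _)
      (cong₂ (λ τ t → ++⁺ τ (t ∷ [])) (id-⨾ ⌜ a ⌝) (substTerm-const ⌜ a ⌝ r))

    atleast-⇔ : ∀ {Γ} r →
      Γ ⊢ (atleast₁ x v F ⌜ a ⌝ (const r) ⇔ Counting.∃≥ x F₁ r [ ⌜ a ⌝ ])
    atleast-⇔ r =
      cast (cong (λ τ → pred (Atleast x v F) τ ⇔ Counting.∃≥ x F₁ r [ ⌜ a ⌝ ]) (vars-const-⨾ r))
        (closureE (cast ([]-id (atleast-Def x v F r)) (axiom (atleast x v F r))) ⌜ a ⌝)

    atmost-⇔ : ∀ {Γ} r →
      Γ ⊢ (atmost₁ x v F ⌜ a ⌝ (const r) ⇔ Counting.∃≤ x F₁ r [ ⌜ a ⌝ ])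
    atmost-⇔ r =
      cast (cong (λ τ → pred (Atmost x v F) τ ⇔ Counting.∃≤ x F₁ r [ ⌜ a ⌝ ]) (vars-const-⨾ r))
        (closureE (cast ([]-id (atmost-Def x v F r)) (axiom (atmost x v F r))) ⌜ a ⌝)

    atleastI : ∀ {Γ} r {Y} → Chain Γ Y → ¬ numeral (+ length Y) ≺ r →
               Γ ⊢ atleast₁ x v F ⌜ a ⌝ (const r)
    atleastI r c p = ⇒E (∧E₂ (atleast-⇔ r)) (∃≥I r c p)

    atleastE : ∀ {Γ C} r → Γ ⊢ atleast₁ x v F ⌜ a ⌝ (const r) →
               (∀ {Γ′} Y → Γ ⊆ Γ′ → Chain Γ′ Y → ¬ numeral (+ length Y) ≺ r → Γ′ ⊢ C) → Γ ⊢ C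
    atleastE r d = ∃≥E r (⇒E (∧E₁ (atleast-⇔ r)) d)

    atmostI : ∀ {Γ} r →
              (∀ {Γ′} Y → Γ ⊆ Γ′ → Chain Γ′ Y → r ≺ numeral (+ length Y) → Γ′ ⊢ ⊥ᶠ) →
              Γ ⊢ atmost₁ x v F ⌜ a ⌝ (const r)
    atmostI r e = ⇒E (∧E₂ (atmost-⇔ r)) (∃≤I r e)

    atmostE : ∀ {Γ} r {Y} → Γ ⊢ atmost₁ x v F ⌜ a ⌝ (const r) → Chain Γ Y →
              r ≺ numeral (+ length Y) → Γ ⊢ ⊥ᶠ
    atmostE r d = ∃≤E r (⇒E (∧E₁ (atmost-⇔ r)) d)

  -- Blocks of variables and joined parameters.

  lookup-vars-⨾ : ∀ {Γ Δ Θ} (ρ : ∀ {s} → s ∈ Γ → s ∈ Δ) (τ : Tuple Θ Δ) {s} (z : s ∈ Γ) →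
                  All.lookup (vars ρ ⨾ τ) z ≡ All.lookup τ (ρ z)
  lookup-vars-⨾ ρ τ z = trans (cong (λ υ → All.lookup υ z) (vars-⨾ ρ τ)) (lookup-tabulate _ z)

  vars-∘ : ∀ {Γ Δ Θ Ξ} (ρ : ∀ {s} → s ∈ Δ → s ∈ Θ) (ρ′ : ∀ {s} → s ∈ Γ → s ∈ Δ) (τ : Tuple Ξ Θ) →
           vars (ρ ∘ ρ′) ⨾ τ ≡ vars ρ′ ⨾ (vars ρ ⨾ τ)
  vars-∘ ρ ρ′ τ = vars-⨾-≡ λ z →
    sym (trans (lookup-vars-⨾ ρ′ (vars ρ ⨾ τ) z) (lookup-vars-⨾ ρ τ (ρ′ z)))

  vars-++ˡ : ∀ {Γ Γ′ Δ} (ρ : Tuple Δ Γ) (τ : Tuple Δ Γ′) → vars ∈-++⁺ˡ ⨾ ++⁺ ρ τ ≡ ρ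
  vars-++ˡ ρ τ = vars-⨾-≡ (lookup-++ˡ ρ τ)

  vars-++ʳ : ∀ {Γ Γ′ Δ} (ρ : Tuple Δ Γ) (τ : Tuple Δ Γ′) → vars (∈-++⁺ʳ Γ) ⨾ ++⁺ ρ τ ≡ τ
  vars-++ʳ ρ τ = vars-⨾-≡ (lookup-++ʳ ρ τ)

  module _ {P : Sort → Set} where

    -- With `++⁺` the result would have index `generals m ++ generals n`, which is not
    -- definitionally `generals (m ℕ.+ n)`, the form of the parameters of an `Atleast` constant.
    join : ∀ m {n} → All P (generals m) → All P (generals n) → All P (generals (m ℕ.+ n))
    join 0       []       qs = qs
    join (suc m) (p ∷ ps) qs = p ∷ join m ps qs

  inˡ : ∀ m {n s} → s ∈ generals m → s ∈ generals (m ℕ.+ n)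
  inˡ (suc m) (here e)  = here e
  inˡ (suc m) (there z) = there (inˡ m z)

  inʳ : ∀ m {n s} → s ∈ generals n → s ∈ generals (m ℕ.+ n)
  inʳ 0       z = z
  inʳ (suc m) z = there (inʳ m z)

  vars-inˡ : ∀ m {n Δ} (X : Tuple Δ (generals m)) (V : Tuple Δ (generals n)) →
             vars (inˡ m {n}) ⨾ join m X V ≡ X
  vars-inˡ m {n} X V = vars-⨾-≡ (lookup-join m X)
    where
    lookup-join : ∀ m X {s} (z : s ∈ generals m) →
                  All.lookup (join m X V) (inˡ m z) ≡ All.lookup X z
    lookup-join (suc m) (_ ∷ X) (here refl) = refl
    lookup-join (suc m) (_ ∷ X) (there z)   = lookup-join m X z

  vars-inʳ : ∀ m {n Δ} (X : Tuple Δ (generals m)) (V : Tuple Δ (generals n)) →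
             vars (inʳ m {n}) ⨾ join m X V ≡ V
  vars-inʳ m {n} X V = vars-⨾-≡ (lookup-join m X)
    where
    lookup-join : ∀ m X {s} (z : s ∈ generals n) →
                  All.lookup (join m X V) (inʳ m z) ≡ All.lookup V z
    lookup-join 0       []      z = refl
    lookup-join (suc m) (_ ∷ X) z = lookup-join m X z

  map-join : ∀ {P Q : Sort → Set} {f : ∀ {s} → P s → Q s} m {n}
             (X : All P (generals m)) (V : All P (generals n)) →
             All.map f (join m X V) ≡ join m (All.map f X) (All.map f V)
  map-join 0       []      V = refl
  map-join (suc m) (_ ∷ X) V = cong (_ ∷_) (map-join m X V)

  -- `replace` acts on the innermost variable only, while the argument N of `Start` is the
  -- outermost. Each new component is plugged into `A`, by way of `substTerm []` since it is closed,
  -- and the recursion treats the rest.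
  replace* : ∀ {Δ Γ} (A : Formula σ₁ Δ) {τ υ : Tuple [] Δ} →
             All.map (λ t → ⟦ t ⟧ᵗ []) τ ≡ All.map (λ t → ⟦ t ⟧ᵗ []) υ →
             Γ ⊢ A [ τ ] → Γ ⊢ A [ υ ]
  replace* A {[]}    {[]}    e d = d
  replace* A {t ∷ τ} {u ∷ υ} e d =
    cast (A-≡ υ) (replace* (A [ substTerm [] u ∷ vars id ]) (cong All.tail e)
      (cast (sym (A-≡ τ)) (replace A (cong All.head e) d)))
    where
    A-≡ : ∀ τ → A [ substTerm [] u ∷ vars id ] [ τ ] ≡ A [ u ∷ τ ]
    A-≡ τ = trans ([]-⨾ A _ τ)
      (cong (A [_]) (cong₂ _∷_ (trans (substTerm-⨾ [] τ u) (substTerm-id u)) (id-⨾ τ)))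

  -- The variables of G are the counted tuple 𝐖 followed by the parameters 𝐗
  -- and 𝐕, which join packs into the single block required by Atleast.
  module StartFormula (x v : ℕ) (F : Formula σ₀ (generals x ++ generals v)) where
    W X : Tuple (generals x ++ generals (x ℕ.+ v)) (generals x)
    W = vars ∈-++⁺ˡ
    X = vars (∈-++⁺ʳ (generals x) ∘ inˡ x)

    V : Tuple (generals x ++ generals (x ℕ.+ v)) (generals v)
    V = vars (∈-++⁺ʳ (generals x) ∘ inʳ x)

    G : Formula σ₀ (generals x ++ generals (x ℕ.+ v))
    G = F [ ++⁺ W V ] ∧ ¬ᶠ (_<*_ {n = x} W X)

    -- Counting alone would allow all the counted tuples to follow 𝐗, so F is asserted of 𝐗
    -- separately. The first disjunct then provides what D₀ demands for N ≤ 0 even where F fails at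
    -- 𝐗.
    startFormula : Formula σ₁ (generals x ++ generals v ++ (integer ∷ []))
    startFormula = cmp le (↑ D.N) (↑ num (+ 0)) ∨
      mapPred base F [ ++⁺ D.X D.V ] ∧ atleast₁ x (x ℕ.+ v) G (join x D.X D.V) (↑ D.N)
      where module D = D₀ x v F

  θ : ∀ {ar} → σ₂ ar → Formula σ₁ ar
  θ (base p)      = pred p (vars id)
  θ (Start x v F) = StartFormula.startFormula x v F

  -- `Start` in terms of chains beginning with a given tuple.

  module D₀-Values (x v : ℕ) (F : Formula σ₀ (generals x ++ generals v))
                   (X : Values x) (a : Values v) (t : Term [] integer) where
    module D = D₀ x v F

    υ : Tuple [] D.Δ
    υ = ++⁺ ⌜ X ⌝ (++⁺ ⌜ a ⌝ (t ∷ []))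

    X-≡ : D.X ⨾ υ ≡ ⌜ X ⌝
    X-≡ = vars-++ˡ ⌜ X ⌝ _

    V-≡ : D.V ⨾ υ ≡ ⌜ a ⌝
    V-≡ = trans (vars-∘ (∈-++⁺ʳ (generals x)) ∈-++⁺ˡ υ)
      (trans (cong (vars ∈-++⁺ˡ ⨾_) (vars-++ʳ ⌜ X ⌝ _)) (vars-++ˡ ⌜ a ⌝ _))

    N-≡ : substTerm υ D.N ≡ t
    N-≡ = trans (lookup-++ʳ ⌜ X ⌝ _ _) (lookup-++ʳ ⌜ a ⌝ _ _)

  module Starts (x v : ℕ) (F : Formula σ₀ (generals x ++ generals v)) (a : Values v) where
    open Counts x v F a
    open StartFormula x v F using (G; startFormula)
    private module S = StartFormula x v F

    Start⟨_,_⟩ : Values x → Term [] integer → Sentence σ₁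
    Start⟨ X , t ⟩ = startFormula [ ++⁺ ⌜ X ⌝ (++⁺ ⌜ a ⌝ (t ∷ [])) ]

    module _ (X : Values x) where
      module GC = Counts x (x ℕ.+ v) G (join x X a)

      GΦ-≡ : ∀ Y → GC.Φ Y ≡ Φ Y ∧ ¬ᶠ (_<*_ {n = x} ⌜ Y ⌝ ⌜ X ⌝)
      GΦ-≡ Y = cong₂ (λ A B → A ∧ ¬ᶠ B)
        (trans (cong (_[ υ ]) (mapPred-[] base F (++⁺ S.W S.V)))
          (trans ([]-⨾ (mapPred base F) (++⁺ S.W S.V) υ)
            (cong (mapPred base F [_]) (trans (map-++ S.W S.V) (cong₂ ++⁺ W-≡ V-≡)))))
        (trans (cong (_[ υ ]) (mapPred-<* {σ₀} {σ₁} base x S.W S.X))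
          (trans (<*-[] x S.W S.X υ) (cong₂ (_<*_ {n = x}) W-≡ X-≡)))
        where
        υ : Tuple [] (generals x ++ generals (x ℕ.+ v))
        υ = ++⁺ ⌜ Y ⌝ ⌜ join x X a ⌝
        υʳ : vars (∈-++⁺ʳ (generals x)) ⨾ υ ≡ join x ⌜ X ⌝ ⌜ a ⌝
        υʳ = trans (vars-++ʳ ⌜ Y ⌝ _) (map-join x X a)
        W-≡ : S.W ⨾ υ ≡ ⌜ Y ⌝
        W-≡ = vars-++ˡ ⌜ Y ⌝ _
        X-≡ : S.X ⨾ υ ≡ ⌜ X ⌝
        X-≡ = trans (vars-∘ (∈-++⁺ʳ (generals x)) (inˡ x) υ)
          (trans (cong (vars (inˡ x) ⨾_) υʳ) (vars-inˡ x ⌜ X ⌝ ⌜ a ⌝))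
        V-≡ : S.V ⨾ υ ≡ ⌜ a ⌝
        V-≡ = trans (vars-∘ (∈-++⁺ʳ (generals x)) (inʳ x) υ)
          (trans (cong (vars (inʳ x) ⨾_) υʳ) (vars-inʳ x ⌜ X ⌝ ⌜ a ⌝))

      Start-≡ : ∀ t → Start⟨ X , t ⟩ ≡
                (cmp le (↑ t) (↑ num (+ 0)) ∨ Φ X ∧ atleast₁ x (x ℕ.+ v) G ⌜ join x X a ⌝ (↑ t))
      Start-≡ t = cong₂ _∨_ (cong (λ u → cmp le (↑ u) _) N-≡) (cong₂ _∧_
        (trans ([]-⨾ (mapPred base F) _ υ)
          (cong (mapPred base F [_]) (trans (map-++ D.X D.V) (cong₂ ++⁺ X-≡ V-≡))))
        (cong (pred _) (trans (map-++ (join x D.X D.V) _) (cong₂ (λ τ u → ++⁺ τ (↑ u ∷ []))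
          (trans (map-join x D.X D.V)
            (trans (cong₂ (join x) X-≡ V-≡) (sym (map-join x X a)))) N-≡))))
        where open D₀-Values x v F X a t

      start≤0I : ∀ {Γ n} → n ℤ.≤ + 0 → Γ ⊢ Start⟨ X , num n ⟩
      start≤0I {n = n} p = cast (sym (Start-≡ (num n))) (∨I₁ (cmpI (numeral-mono-≤ p)))

      -- No member of an increasing chain precedes its head, so the same list is a chain for `G`.
      startI : ∀ {Γ n L} → Chain Γ (X ∷ L) → n ℤ.≤ + suc (length L) → Γ ⊢ Start⟨ X , num n ⟩
      startI {Γ} {n} {L} (chain (X< ∷ inc) sat) p = cast (sym (Start-≡ (num n)))
        (∨I₂ (∧I (All.head sat) (GC.atleastI (numeral n)
          (GC.chain (X< ∷ inc) (All.zipWith (uncurry f) (sat , ≮X)))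
          (λ q → ℤ.<⇒≱ (numeral-cancel-≺ q) p))))
        where
        ≮X : All (λ Y → ¬ Lex x Y X) (X ∷ L)
        ≮X = (λ q → Lex-irrefl x q refl) ∷
             All.map (λ X<Y Y<X → Lex-irrefl x (Lex-trans x X<Y Y<X) refl) X<
        f : ∀ {Y} → Γ ⊢ Φ Y → ¬ Lex x Y X → Γ ⊢ GC.Φ Y
        f {Y} d ¬Y<X = cast (sym (GΦ-≡ Y)) (∧I d (⇒I (<*E x Y X ¬Y<X hyp₀)))

      -- The `Atleast` atom gives a chain for `G` that may miss `X`. If its least entry is `X`,
      -- nothing is to be done; if it follows `X`, then `X` is prepended, which the lower bound on
      -- the length tolerates; it cannot precede `X` by the definition of `G`.
      startE : ∀ {Γ C n} → ¬ n ℤ.≤ + 0 → Γ ⊢ Start⟨ X , num n ⟩ →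
               (∀ {Γ′} L → Γ ⊆ Γ′ → Chain Γ′ (X ∷ L) → n ℤ.≤ + suc (length L) → Γ′ ⊢ C) → Γ ⊢ C
      startE {Γ} {C} {n} n≰0 d e = ∨E (cast (Start-≡ (num n)) d)
        (cmpE (n≰0 ∘ numeral-cancel-≼) hyp₀)
        (GC.atleastE (numeral n) (∧E₂ hyp₀) f)
        where
        f : ∀ {Γ′} Y → (Φ X ∧ atleast₁ x (x ℕ.+ v) G ⌜ join x X a ⌝ (↑ num n)) ∷ Γ ⊆ Γ′ →
            GC.Chain Γ′ Y → ¬ numeral (+ length Y) ≺ numeral n → Γ′ ⊢ C
        -- An empty chain would give `n` ≤ 0.
        f []      Γ⊆ _ p = ⊥-elim (n≰0 (numeral-≮⇒≥ p))
        f {Γ′} (Y ∷ L) Γ⊆ (GC.chain (Y< ∷ inc) sat) p with Lex-compare x X Y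
        ... | tri< X<Y _ _ = e (Y ∷ L) (Γ⊆ ∘ there)
          (chain ((X<Y ∷ All.map (Lex-trans x X<Y) Y<) ∷ Y< ∷ inc)
                 (∧E₁ (hyp (Γ⊆ (here refl))) ∷ sat-F))
          (ℤ.≤-trans (numeral-≮⇒≥ p) (ℤ.+≤+ (ℕ.n≤1+n _)))
          where
          sat-F : All (λ Z → Γ′ ⊢ Φ Z) (Y ∷ L)
          sat-F = All.map (λ {Z} d → ∧E₁ (cast (GΦ-≡ Z) d)) sat
        ... | tri≈ _ refl _ = e L (Γ⊆ ∘ there)
          (chain (Y< ∷ inc) (All.map (λ {Z} d → ∧E₁ (cast (GΦ-≡ Z) d)) sat)) (numeral-≮⇒≥ p)
        ... | tri> _ _ Y<X = ⊥E (⇒E (∧E₂ (cast (GΦ-≡ Y) (All.head sat))) (<*I x Y X Y<X))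

      Start-cong : ∀ {Γ t u} → ⟦ t ⟧ᵗ [] ≡ ⟦ u ⟧ᵗ [] → Γ ⊢ Start⟨ X , t ⟩ → Γ ⊢ Start⟨ X , u ⟩
      Start-cong {t = t} {u} e = replace* startFormula
        (trans (values t) (trans (cong (λ n → ++⁺ X (++⁺ a (n ∷ []))) e) (sym (values u))))
        where
        value-⌜⌝ : ∀ {Δ} (η : Env Δ) → All.map (λ t → ⟦ t ⟧ᵗ []) ⌜ η ⌝ ≡ η
        value-⌜⌝ []                = refl
        value-⌜⌝ (_∷_ {general} r η) = cong₂ _∷_ (⟦const⟧ r []) (value-⌜⌝ η)
        value-⌜⌝ (_∷_ {integer} n η) = cong (n ∷_) (value-⌜⌝ η)
        values : ∀ t → All.map (λ t → ⟦ t ⟧ᵗ []) (++⁺ ⌜ X ⌝ (++⁺ ⌜ a ⌝ (t ∷ []))) ≡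
                       ++⁺ X (++⁺ a (⟦ t ⟧ᵗ [] ∷ []))
        values t = trans (map-++ ⌜ X ⌝ _) (cong₂ ++⁺ (value-⌜⌝ X)
          (trans (map-++ ⌜ a ⌝ _) (cong (λ τ → ++⁺ τ _) (value-⌜⌝ a))))

      open Soundness θ

      start-⟪⟫ : ∀ {Δ t} {υ : Tuple [] Δ}
                 {X′ : Tuple Δ (generals x)} {V′ : Tuple Δ (generals v)} {N′} →
                 X′ ⨾ υ ≡ ⌜ X ⌝ → V′ ⨾ υ ≡ ⌜ a ⌝ → substTerm υ N′ ≡ t →
                 start x v F X′ V′ N′ ⟪ υ ⟫ ≡ Start⟨ X , t ⟩
      start-⟪⟫ {υ = υ} {X′} {V′} eX eV eN = trans ([]-⨾ startFormula _ υ)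
        (cong (startFormula [_]) (trans (map-++ X′ _) (cong₂ ++⁺ eX
          (trans (map-++ V′ _) (cong₂ (λ τ u → ++⁺ τ (u ∷ [])) eV eN)))))

  ⊀⇒≽ : ∀ {a b} → ¬ a ≺ b → ⟦ le ⟧ᶜ b a
  ⊀⇒≽ {a} {b} a⊀b with compare a b
  ... | tri< a≺b _ _  = ⊥-elim (a⊀b a≺b)
  ... | tri≈ _ refl _ = inj₂ refl
  ... | tri> _ _ b≺a  = inj₁ b≺a

  ≽⇒⊀ : ∀ {a b} → ⟦ le ⟧ᶜ b a → ¬ a ≺ b
  ≽⇒⊀ (inj₁ b≺a)  = ≺-asym b≺a
  ≽⇒⊀ (inj₂ refl) = ≺-irrefl refl

  ≼-≺-trans : ∀ {a b c} → ⟦ le ⟧ᶜ a b → b ≺ c → a ≺ c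
  ≼-≺-trans (inj₁ a≺b)  b≺c = ≺-trans a≺b b≺c
  ≼-≺-trans (inj₂ refl) b≺c = b≺c

  ≺-≼-trans : ∀ {a b c} → a ≺ b → ⟦ le ⟧ᶜ b c → a ≺ c
  ≺-≼-trans a≺b (inj₁ b≺c)  = ≺-trans a≺b b≺c
  ≺-≼-trans a≺b (inj₂ refl) = a≺b

  +1-cancel-≤ : ∀ {n k} → n ℤ.+ + 1 ℤ.≤ + suc k → n ℤ.≤ + k
  +1-cancel-≤ {+ m} {k}  (ℤ.+≤+ p) = ℤ.+≤+ (ℕ.s≤s⁻¹ (subst (ℕ._≤ suc k) (ℕ.+-comm m 1) p))
  +1-cancel-≤ { -[1+ m ]} p        = ℤ.-≤+

  +1-mono-≤ : ∀ {n k} → n ℤ.≤ + k → n ℤ.+ + 1 ℤ.≤ + suc k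
  +1-mono-≤ {n} {k} p = subst (λ m → n ℤ.+ + 1 ℤ.≤ + m) (ℕ.+-comm k 1) (ℤ.+-monoˡ-≤ (+ 1) p)

  -- An arbitrary tuple: D₁ quantifies over 𝐗 even when the chain at hand is empty and offers no
  -- head.
  zeros : ∀ n → Values n
  zeros 0       = []
  zeros (suc n) = numeral (+ 0) ∷ zeros n

  substTerm-++ʳ : ∀ {Γ Γ′ Δ s} (ρ : Tuple Δ Γ) (τ : Tuple Δ Γ′) (t : Term Γ′ s) →
                  substTerm (++⁺ ρ τ) (renameTerm (∈-++⁺ʳ Γ) t) ≡ substTerm τ t
  substTerm-++ʳ {Γ} ρ τ t = begin
    substTerm (++⁺ ρ τ) (renameTerm (∈-++⁺ʳ Γ) t)
      ≡⟨ cong (substTerm _) (substTerm-vars (∈-++⁺ʳ Γ) t) ⟨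
    substTerm (++⁺ ρ τ) (substTerm (vars (∈-++⁺ʳ Γ)) t)
      ≡⟨ substTerm-⨾ _ _ t ⟩
    substTerm (vars (∈-++⁺ʳ Γ) ⨾ ++⁺ ρ τ) t
      ≡⟨ cong (λ υ → substTerm υ t) (vars-++ʳ ρ τ) ⟩
    substTerm τ t ∎

  rename-++ʳ-⨾ : ∀ {Γ Γ′ Γ″ Δ} (ρ : Tuple Δ Γ) (τ : Tuple Δ Γ′) (υ : Tuple Γ′ Γ″) →
                 All.map (renameTerm (∈-++⁺ʳ Γ)) υ ⨾ ++⁺ ρ τ ≡ υ ⨾ τ
  rename-++ʳ-⨾ ρ τ []      = refl
  rename-++ʳ-⨾ ρ τ (t ∷ υ) = cong₂ _∷_ (substTerm-++ʳ ρ τ t) (rename-++ʳ-⨾ ρ τ υ)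

  split : ∀ Γ {Γ′} (η : Env (Γ ++ Γ′)) → ∃[ η₁ ] ∃[ η₂ ] η ≡ ++⁺ {xs = Γ} {Γ′} η₁ η₂
  split []      η       = [] , η , refl
  split (_ ∷ Γ) (a ∷ η) with split Γ η
  ... | η₁ , η₂ , refl = a ∷ η₁ , η₂ , refl

  mapPred-id : ∀ {σ : Signature} {Δ} (A : Formula σ Δ) → mapPred id A ≡ A
  mapPred-id (pred p ts) = refl
  mapPred-id (cmp c t u) = refl
  mapPred-id ⊥ᶠ          = refl
  mapPred-id (A ∧ B)     = cong₂ _∧_ (mapPred-id A) (mapPred-id B)
  mapPred-id (A ∨ B)     = cong₂ _∨_ (mapPred-id A) (mapPred-id B)
  mapPred-id (A ⇒ B)     = cong₂ _⇒_ (mapPred-id A) (mapPred-id B)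
  mapPred-id (∀ᶠ A)      = cong ∀ᶠ (mapPred-id A)
  mapPred-id (∃ᶠ A)      = cong ∃ᶠ (mapPred-id A)

  -- Soundness of D₀ and D₁, and conservativity.

  module _ where
    open Soundness θ

    closure-sound : ∀ {Θ} Δ (B : Formula σ₂ Δ) {Γ} (τ : Tuple [] Θ) →
                    (∀ η → Γ ⊢ B ⟪ ⌜ η ⌝ ⟫) → Γ ⊢ (closure Δ B [ [] ]) ⟪ τ ⟫
    closure-sound Δ B τ d = cast (sym (begin
      (closure Δ B [ [] ]) ⟪ τ ⟫         ≡⟨ ⟪⟫-[] (closure Δ B) [] τ ⟩
      interpret θ (closure Δ B) [ [] ]   ≡⟨ []-id _ ⟩
      interpret θ (closure Δ B)          ≡⟨ interpret-closure θ Δ B ⟩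
      closure Δ (interpret θ B)          ∎)) (closureI Δ d)

    module _ (x v : ℕ) (F : Formula σ₀ (generals x ++ generals v)) where

      D₀-closure-sound : ∀ {Θ} (B : Formula σ₂ (D₀.Δ x v F)) {Γ} (τ : Tuple [] Θ) →
        (∀ X a n → Γ ⊢ B ⟪ ++⁺ ⌜ X ⌝ (++⁺ ⌜ a ⌝ (num n ∷ [])) ⟫) →
        Γ ⊢ (closure (D₀.Δ x v F) B [ [] ]) ⟪ τ ⟫
      D₀-closure-sound B {Γ} τ d = closure-sound (D₀.Δ x v F) B τ f
        where
        f : ∀ η → Γ ⊢ B ⟪ ⌜ η ⌝ ⟫
        f η with split (generals x) η
        ... | X , η₁ , refl with split (generals v) η₁
        ...   | a , n ∷ [] , refl = cast (cong (B ⟪_⟫) (sym (trans (map-++ X _)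
          (cong (++⁺ ⌜ X ⌝) (map-++ a (n ∷ [])))))) (d X a n)

      module _ (X : Values x) (a : Values v) (n : ℤ) where
        open D₀-Values x v F X a (num n)
        open Starts x v F a
        open Counts x v F a

        N-cmp-≡ : ∀ c → _≡_ {A = Sentence σ₁} (cmp c (↑ D.N) (↑ num (+ 0)) [ υ ])
                                              (cmp c (↑ num n) (↑ num (+ 0)))
        N-cmp-≡ c = cong (λ t → cmp c (↑ t) (↑ num (+ 0))) N-≡

        start-N-≡ : start x v F D.X D.V D.N ⟪ υ ⟫ ≡ Start⟨ X , num n ⟩
        start-N-≡ = start-⟪⟫ X X-≡ V-≡ N-≡

        F′-≡ : D.F′ ⟪ υ ⟫ ≡ Φ X
        F′-≡ = begin
          interpret θ (F₂ [ ++⁺ D.X D.V ]) [ υ ]   ≡⟨ ⟪⟫-[] F₂ _ υ ⟩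
          interpret θ F₂ [ ++⁺ D.X D.V ⨾ υ ]
            ≡⟨ cong₂ _[_] (interpret-mapPred θ {f = λ p → σ₂.base (σ₁.base p)} {g = base}
                                             (λ _ → refl) F)
                          (trans (map-++ D.X D.V) (cong₂ ++⁺ X-≡ V-≡)) ⟩
          Φ X ∎
          where
          F₂ : Formula σ₂ (generals x ++ generals v)
          F₂ = mapPred (λ p → σ₂.base (σ₁.base p)) F

        start≤0-at : ∀ {Γ} → Γ ⊢ (cmp le (↑ D.N) (↑ num (+ 0)) ⇒ start x v F D.X D.V D.N) ⟪ υ ⟫
        start≤0-at = ⇒I (cast (sym start-N-≡) start-N)
          where
          start-N : _ ⊢ Start⟨ X , num n ⟩
          start-N with n ℤ.≤? + 0
          ... | yes n≤0 = start≤0I X n≤0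
          ... | no  n≰0 = cmpE (n≰0 ∘ numeral-cancel-≼) (cast (N-cmp-≡ le) hyp₀)

        start₁-at : ∀ {Γ} → Γ ⊢ (start x v F D.X D.V (num (+ 1)) ⇔ D.F′) ⟪ υ ⟫
        start₁-at = cast (sym (cong₂ _⇔_ (start-⟪⟫ X X-≡ V-≡ refl) F′-≡)) (∧I
          (⇒I (startE X (λ { (ℤ.+≤+ ()) }) hyp₀ λ { _ _ (chain _ (d ∷ _)) _ → d }))
          (⇒I (startI X (chain ([] ∷ []) (hyp₀ ∷ [])) ℤ.≤-refl)))

        module _ where
          -- These repeat the definitions local to `D₀.start₊`, so that its existential part can be
          -- named here.
          up₁ : ∀ {s} → Term D.Δ s → Term (generals x ++ D.Δ) s
          up₁ = renameTerm (∈-++⁺ʳ (generals x))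
          up : ∀ {Γ} → Tuple D.Δ Γ → Tuple (generals x ++ D.Δ) Γ
          up = All.map up₁
          U′ : Tuple (generals x ++ D.Δ) (generals x)
          U′ = vars ∈-++⁺ˡ

          later : Formula σ₂ (generals x ++ D.Δ)
          later = _<*_ {n = x} (up D.X) U′ ∧ start x v F U′ (up D.V) (up₁ D.N)

          later-≡ : ∀ U → later ⟪ ++⁺ ⌜ U ⌝ υ ⟫ ≡ (_<*_ {n = x} ⌜ X ⌝ ⌜ U ⌝ ∧ Start⟨ U , num n ⟩)
          later-≡ U = cong₂ _∧_
            (trans (cong (_[ ++⁺ ⌜ U ⌝ υ ]) (interpret-<* θ x (up D.X) U′))
              (trans (<*-[] x (up D.X) U′ _) (cong₂ (_<*_ {n = x})
                (trans (rename-++ʳ-⨾ ⌜ U ⌝ υ D.X) X-≡) (vars-++ˡ ⌜ U ⌝ υ))))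
            (start-⟪⟫ U (vars-++ˡ ⌜ U ⌝ υ) (trans (rename-++ʳ-⨾ ⌜ U ⌝ υ D.V) V-≡)
              (trans (substTerm-++ʳ ⌜ U ⌝ υ D.N) N-≡))

          -- A chain of at least n + 1 entries beginning with 𝐗 is 𝐗 followed by a chain of at least
          -- n entries whose head is larger: one direction removes the head, the other prepends it.
          start₊-at : ∀ {Γ} → Γ ⊢ (cmp gt (↑ D.N) (↑ num (+ 0)) ⇒
            (start x v F D.X D.V (D.N ⊕ num (+ 1)) ⇔ D.F′ ∧ ∃* (generals x) later)) ⟪ υ ⟫
          start₊-at {Γ} with n ℤ.≤? + 0
          ... | yes n≤0 = ⇒I (cmpE (λ 0≺n → ℤ.≤⇒≯ n≤0 (numeral-cancel-≺ 0≺n))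
                               (cast (N-cmp-≡ gt) hyp₀))
          ... | no  n≰0 = ⇒I (cast (sym (cong₂ _⇔_ (start-⟪⟫ X X-≡ V-≡ (cong (_⊕ num (+ 1)) N-≡))
              (cong₂ _∧_ F′-≡ (cong (_[ υ ]) (interpret-∃* θ (generals x) later)))))
              (∧I (⇒I forth) (⇒I back)))
            where
            later′ : Sentence σ₁
            later′ = ∃* (generals x) (interpret θ later) [ υ ]

            forth : ∀ {Γ} → Start⟨ X , num n ⊕ num (+ 1) ⟩ ∷ Γ ⊢ Φ X ∧ later′
            forth = startE X n+1≰0 (Start-cong X refl hyp₀) λ
              -- Without a second entry n + 1 ≤ 1, contrary to n > 0.
              { []      _ _ n+1≤1 → ⊥-elim (n≰0 (+1-cancel-≤ n+1≤1))
              ; (U ∷ L) _ (chain ((X<U ∷ _) ∷ inc) (d ∷ ds)) p →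
                ∧I d (∃*I υ ⌜ U ⌝ (cast (sym (later-≡ U)) (∧I (<*I x X U X<U)
                  (startI U (chain inc ds) (+1-cancel-≤ p))))) }
              where
              n+1≰0 : ¬ n ℤ.+ + 1 ℤ.≤ + 0
              n+1≰0 p = n≰0 (ℤ.≤-trans (ℤ.i≤i+j n (+ 1)) p)

            back : ∀ {Γ} → (Φ X ∧ later′) ∷ Γ ⊢ Start⟨ X , num n ⊕ num (+ 1) ⟩
            back {Γ} = ∃*E υ (generals x) (∧E₂ hyp₀) f
              where
              f : ∀ U {Γ′} → (Φ X ∧ later′) ∷ Γ ⊆ Γ′ → Γ′ ⊢ later ⟪ ++⁺ ⌜ U ⌝ υ ⟫ →
                  Γ′ ⊢ Start⟨ X , num n ⊕ num (+ 1) ⟩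
              f U Γ⊆ d with Lex-compare x X U
              ... | tri< X<U _ _ = startE U n≰0 (∧E₂ (cast (later-≡ U) d)) λ
                { L Γ⊆′ (chain (U< ∷ inc) ds) p → Start-cong X refl (startI X
                  (chain ((X<U ∷ All.map (Lex-trans x X<U) U<) ∷ U< ∷ inc)
                         (∧E₁ (hyp (Γ⊆′ (Γ⊆ (here refl)))) ∷ ds))
                  (+1-mono-≤ p)) }
              ... | tri≈ ¬p _ _ = <*E x X U ¬p (∧E₁ (cast (later-≡ U) d))
              ... | tri> ¬p _ _ = <*E x X U ¬p (∧E₁ (cast (later-≡ U) d))

      module _ (a : Values v) (r : PTerm) where
        module D = D₁ x v F
        open Starts x v F a
        open Counts x v F a

        υ : Tuple [] D.Δ
        υ = ++⁺ ⌜ a ⌝ (const r ∷ [])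

        V-≡ : D.V ⨾ υ ≡ ⌜ a ⌝
        V-≡ = vars-++ˡ ⌜ a ⌝ _

        Y-≡ : substTerm υ D.Y ≡ const r
        Y-≡ = lookup-++ʳ ⌜ a ⌝ _ _

        args-≡ : vars id ⨾ ++⁺ D.V (D.Y ∷ []) ⨾ υ ≡ ++⁺ ⌜ a ⌝ (const r ∷ [])
        args-≡ = trans (cong (_⨾ υ) (id-⨾ _)) (trans (map-++ D.V _)
          (cong₂ (λ τ t → ++⁺ τ (t ∷ [])) V-≡ Y-≡))

        module _ (U : Values x) (m : ℤ) where
          υ′ : Tuple [] D.Δ′
          υ′ = ++⁺ (++⁺ ⌜ U ⌝ (num m ∷ [])) υ

          N-≡ : substTerm υ′ D.N ≡ num m
          N-≡ = trans (lookup-++ˡ (++⁺ ⌜ U ⌝ (num m ∷ [])) υ _) (lookup-++ʳ ⌜ U ⌝ _ _)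

          start-≡ : start x v F D.X (All.map D.up D.V) D.N ⟪ υ′ ⟫ ≡ Start⟨ U , num m ⟩
          start-≡ = start-⟪⟫ U
            (trans (vars-∘ ∈-++⁺ˡ ∈-++⁺ˡ υ′)
              (trans (cong (vars ∈-++⁺ˡ ⨾_) (vars-++ˡ (++⁺ ⌜ U ⌝ (num m ∷ [])) υ))
                     (vars-++ˡ ⌜ U ⌝ _)))
            (trans (rename-++ʳ-⨾ (++⁺ ⌜ U ⌝ (num m ∷ [])) υ D.V) V-≡)
            N-≡

          cmp-≡ : ∀ c → _≡_ {A = Sentence σ₁} (cmp c (↑ D.N) (D.up D.Y) [ υ′ ])
                                              (cmp c (↑ num m) (const r))
          cmp-≡ c = cong₂ (λ t u → cmp c (↑ t) u) N-≡
            (trans (substTerm-++ʳ (++⁺ ⌜ U ⌝ (num m ∷ [])) υ D.Y) Y-≡)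

        ∃*-sound : ∀ {Γ C} (B : Formula σ₂ D.Δ′) →
                   Γ ⊢ ∃* (generals x ++ (integer ∷ [])) B ⟪ υ ⟫ →
                   (∀ U m {Γ′} → Γ ⊆ Γ′ → Γ′ ⊢ B ⟪ υ′ U m ⟫ → Γ′ ⊢ C) → Γ ⊢ C
        ∃*-sound {Γ} {C} B d e = ∃*E υ (generals x ++ (integer ∷ []))
          (cast (cong (_[ υ ]) (interpret-∃* θ (generals x ++ (integer ∷ [])) B)) d) f
          where
          f : ∀ η {Γ′} → Γ ⊆ Γ′ → Γ′ ⊢ B ⟪ ++⁺ ⌜ η ⌝ υ ⟫ → Γ′ ⊢ C
          f η Γ⊆ d with split (generals x) η
          ... | U , m ∷ [] , refl =
            e U m Γ⊆ (cast (cong (λ ρ → B ⟪ ++⁺ ρ υ ⟫) (map-++ U (m ∷ []))) d)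

        ∀*-sound : ∀ {Γ} (B : Formula σ₂ D.Δ′) → (∀ U m → Γ ⊢ B ⟪ υ′ U m ⟫) →
                   Γ ⊢ ∀* (generals x ++ (integer ∷ [])) B ⟪ υ ⟫
        ∀*-sound {Γ} B d =
          cast (cong (_[ υ ]) (sym (interpret-∀* θ (generals x ++ (integer ∷ [])) B)))
            (∀*I υ (generals x ++ (integer ∷ [])) f)
          where
          f : ∀ η → Γ ⊢ B ⟪ ++⁺ ⌜ η ⌝ υ ⟫
          f η with split (generals x) η
          ... | U , m ∷ [] , refl =
            cast (cong (λ ρ → B ⟪ ++⁺ ρ υ ⟫) (sym (map-++ U (m ∷ [])))) (d U m)

        start-ge start-le : Formula σ₂ D.Δ′
        start-ge = start x v F D.X (All.map D.up D.V) D.N ∧ cmp ge (↑ D.N) (D.up D.Y)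
        start-le = start x v F D.X (All.map D.up D.V) D.N ⇒ cmp le (↑ D.N) (D.up D.Y)

        start-ge-≡ : ∀ U m → start-ge ⟪ υ′ U m ⟫ ≡ (Start⟨ U , num m ⟩ ∧ cmp ge (↑ num m) (const r))
        start-ge-≡ U m = cong₂ _∧_ (start-≡ U m) (cmp-≡ U m ge)

        start-le-≡ : ∀ U m → start-le ⟪ υ′ U m ⟫ ≡ (Start⟨ U , num m ⟩ ⇒ cmp le (↑ num m) (const r))
        start-le-≡ U m = cong₂ _⇒_ (start-≡ U m) (cmp-≡ U m le)

        -- A chain supplies its head as 𝐗 and its own length as N; `r` could not serve as N, since
        -- it need not be a numeral.
        atleast-at : ∀ {Γ} → Γ ⊢ (mapPred base (atleast₁ x v F D.V D.Y) ⇔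
                                  ∃* (generals x ++ (integer ∷ [])) start-ge) ⟪ υ ⟫
        atleast-at {Γ} = cast (cong (_⇔ ∃ge) (cong (pred _) (sym args-≡)))
          (∧I (⇒I (atleastE r hyp₀ forth)) (⇒I (∃*-sound start-ge hyp₀ back)))
          where
          ∃ge : Sentence σ₁
          ∃ge = ∃* (generals x ++ (integer ∷ [])) start-ge ⟪ υ ⟫

          ∃geI : ∀ {Γ} U {m} → Γ ⊢ Start⟨ U , num m ⟩ → ¬ numeral m ≺ r → Γ ⊢ ∃ge
          ∃geI U {m} d p =
            cast (cong (_[ υ ]) (sym (interpret-∃* θ (generals x ++ (integer ∷ [])) start-ge)))
            (∃*I υ (++⁺ ⌜ U ⌝ (num m ∷ []))
              (cast (sym (start-ge-≡ U m)) (∧I d (const-cmpI (⊀⇒≽ p)))))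

          forth : ∀ {Γ″ Γ′} Y → Γ″ ⊆ Γ′ → Chain Γ′ Y → ¬ numeral (+ length Y) ≺ r → Γ′ ⊢ ∃ge
          forth []      _ _ p = ∃geI (zeros x) (start≤0I (zeros x) ℤ.≤-refl) p
          forth (U ∷ L) _ c p = ∃geI U (startI U c ℤ.≤-refl) p

          back : ∀ {Γ″} U m {Γ′} → Γ″ ⊆ Γ′ → Γ′ ⊢ start-ge ⟪ υ′ U m ⟫ →
                 Γ′ ⊢ atleast₁ x v F ⌜ a ⌝ (const r)
          back U m _ d with numeral m <? r | m ℤ.≤? + 0
          ... | yes m≺r | _       = const-cmpE (λ r≼m → ≽⇒⊀ r≼m m≺r) (∧E₂ (cast (start-ge-≡ U m) d))
          -- For N ≤ 0 `Start` yields no chain, but then `r` ≤ N ≤ 0 and the empty chain suffices.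
          ... | no  m⊀r | yes m≤0 =
            atleastI r (chain [] []) (m⊀r ∘ ≼-≺-trans (numeral-mono-≤ m≤0))
          ... | no  m⊀r | no  m≰0 = startE U m≰0 (∧E₁ (cast (start-ge-≡ U m) d))
            λ L _ c p → atleastI r c (m⊀r ∘ ≼-≺-trans (numeral-mono-≤ p))

        -- Whether N exceeds `r` is decided outside the calculus; only if it does is a contradiction
        -- drawn, from a chain longer than `r`. Conversely, such a chain makes `Start` derivable at
        -- its own length, which violates the bound.
        atmost-at : ∀ {Γ} → Γ ⊢ (mapPred base (atmost₁ x v F D.V D.Y) ⇔
                                 ∀* (generals x ++ (integer ∷ [])) start-le) ⟪ υ ⟫
        atmost-at {Γ} = cast (cong (_⇔ ∀le) (cong (pred _) (sym args-≡)))
          (∧I (⇒I (∀*-sound start-le forth)) (⇒I (atmostI r back)))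
          where
          ∀le : Sentence σ₁
          ∀le = ∀* (generals x ++ (integer ∷ [])) start-le ⟪ υ ⟫

          ∀leE : ∀ {Γ} U {m} → Γ ⊢ ∀le → Γ ⊢ Start⟨ U , num m ⟩ → r ≺ numeral m → Γ ⊢ ⊥ᶠ
          ∀leE U {m} d e r≺m = const-cmpE (λ m≼r → ≽⇒⊀ m≼r r≺m) (⇒E (cast (start-le-≡ U m)
            (∀*E υ (cast (cong (_[ υ ]) (interpret-∀* θ (generals x ++ (integer ∷ [])) start-le)) d)
              (++⁺ ⌜ U ⌝ (num m ∷ [])))) e)

          forth : ∀ {Γ} U m → atmost₁ x v F ⌜ a ⌝ (const r) ∷ Γ ⊢ start-le ⟪ υ′ U m ⟫
          forth U m = cast (sym (start-le-≡ U m)) (⇒I bounded)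
            where
            bounded : ∀ {Γ} → Start⟨ U , num m ⟩ ∷ atmost₁ x v F ⌜ a ⌝ (const r) ∷ Γ ⊢
                              cmp le (↑ num m) (const r)
            bounded with r <? numeral m | m ℤ.≤? + 0
            ... | no  r⊀m | _       = const-cmpI (⊀⇒≽ r⊀m)
            -- Here `r` lies below 0, so the empty chain contradicts `Atmost`, whatever `Start`
            -- says.
            ... | yes r≺m | yes m≤0 = ⊥E (atmostE r (hyp (there (here refl))) (chain [] [])
              (≺-≼-trans r≺m (numeral-mono-≤ m≤0)))
            ... | yes r≺m | no  m≰0 = startE U m≰0 hyp₀ λ L Γ⊆ c p →
              ⊥E (atmostE r (hyp (Γ⊆ (there (here refl)))) c (≺-≼-trans r≺m (numeral-mono-≤ p)))

          back : ∀ {Γ Γ′} Y → ∀le ∷ Γ ⊆ Γ′ → Chain Γ′ Y → r ≺ numeral (+ length Y) → Γ′ ⊢ ⊥ᶠ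
          back []      Γ⊆ _ p =
            ∀leE (zeros x) (hyp (Γ⊆ (here refl))) (start≤0I (zeros x) ℤ.≤-refl) p
          back (U ∷ L) Γ⊆ c p = ∀leE U (hyp (Γ⊆ (here refl))) (startI U c ℤ.≤-refl) p

      D₁-closure-sound : ∀ {Θ} (B : Formula σ₂ (D₁.Δ x v F)) {Γ} (τ : Tuple [] Θ) →
        (∀ a r → Γ ⊢ B ⟪ ++⁺ ⌜ a ⌝ (const r ∷ []) ⟫) →
        Γ ⊢ (closure (D₁.Δ x v F) B [ [] ]) ⟪ τ ⟫
      D₁-closure-sound B {Γ} τ d = closure-sound (D₁.Δ x v F) B τ f
        where
        f : ∀ η → Γ ⊢ B ⟪ ⌜ η ⌝ ⟫
        f η with split (generals v) η
        ... | a , r ∷ [] , refl = cast (cong (B ⟪_⟫) (sym (map-++ a (r ∷ [])))) (d a r)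

    axiom-sound : ∀ {Δ Γ} {A : Formula σ₂ Δ} → HT#-Axiom A → (τ : Tuple [] Δ) → Γ ⊢ A ⟪ τ ⟫
    axiom-sound (common c)          τ = common-sound c τ
    axiom-sound (ind F)             τ = induction-sound θ F τ
    axiom-sound (start≤0 x v F)     τ = D₀-closure-sound x v F _ τ λ X a n → start≤0-at x v F X a n
    axiom-sound (start₁ x v F)      τ = D₀-closure-sound x v F _ τ λ X a n → start₁-at x v F X a n
    axiom-sound (start₊ x v F)      τ = D₀-closure-sound x v F _ τ λ X a n → start₊-at x v F X a n
    axiom-sound (atleast-def x v F) τ = D₁-closure-sound x v F _ τ λ a r → atleast-at x v F a r
    axiom-sound (atmost-def x v F)  τ = D₁-closure-sound x v F _ τ λ a r → atmost-at x v F a r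

    -- `θ` leaves the constants of `σ₁` as they are, so the sentence obtained from soundness is `F`
    -- itself.
    conservative : (F : Sentence σ₁) → HT#⊢ (mapPred base F) → HT#ω⊢ F
    conservative F d = cast (begin
      mapPred base F ⟪ [] ⟫         ≡⟨ []-id _ ⟩
      interpret θ (mapPred base F)  ≡⟨ interpret-mapPred θ {f = σ₂.base} {g = id} (λ _ → refl) F ⟩
      mapPred id F                  ≡⟨ mapPred-id F ⟩
      F                             ∎) (sound axiom-sound d [])

theorem5 : (𝒱 : Vocabulary) → let open Logic 𝒱 in
  (F : Sentence σ₁) → HT#⊢ (mapPred base F) → HT#ω⊢ F
theorem5 = conservative
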